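{- Let $w\in\mathbb{C}$ be fixed and $n\ge 4$. For $1\le l<j<r\le n$ let $f_{n,l,j,r}=\frac12\left(w^{j-l}+w^{r-j}\right)$ if the triangle with vertices $v_{n,l},v_{n,j},v_{n,r}$ has exactly one side in common with the perimeter of the convex $n$-gon $P_n$, and $f_{n,l,j,r}=0$ otherwise. Let $\mathcal{S}_n$ be the sum of the weights $f_{n,l,j,r}$ over all triangles of a uniformly random triangulation of $P_n$. Then $$\mathbb{E}(\mathcal{S}_n)=-\frac{(n-1)(2w^{n-2}+3w)}{2(2n-5)}+\frac{3w}{C_{n-2}}\sum_{j=0}^{n-3}w^jC_j\binom{2n-6-2j}{n-3-j}-\frac{w}{2C_{n-2}}\sum_{j=0}^{n-3}w^jC_j\binom{2n-4-2j}{n-2-j}.$$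
   Context: $P_n$ is a convex polygon with vertices $v_{n,1},\dots,v_{n,n}$ in clockwise order (so its sides are $v_{n,i}v_{n,i+1}$ for $1\le i\le n-1$, together with $v_{n,1}v_{n,n}$). A triangulation of $P_n$ is a set of $n-3$ noncrossing diagonals partitioning $P_n$ into $n-2$ triangles; there are $C_{n-2}$ of them, where $C_k=\frac{1}{k+1}\binom{2k}{k}$, and the random triangulation is chosen uniformly among them. $w^0=1$. -}

module Defs where

open import Algebra.Bundles using (CommutativeRing)
import Algebra.Properties.Ring as RingProperties
import Algebra.Properties.Semiring.Exp as Exp
import Algebra.Solver.Ring.NaturalCoefficients.Default as NatSolver
open import Data.Bool.Base using (if_then_else_)
open import Data.Fin.Base as Fin using (Fin; toℕ)
import Data.Fin.Properties as Fin
open import Data.Integer.Base as ℤ using (+_)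
open import Data.List.Base
  using (List; []; _∷_; _++_; map; filter; foldr; length; upTo; allFin; cartesianProduct)
import Data.List.Membership.DecPropositional as DecMembership
open import Data.List.Membership.Propositional using (_∈_)
open import Data.List.Relation.Unary.AllPairs using (AllPairs; allPairs?)
open import Data.Nat.Base as ℕ using (ℕ; zero; suc; _∸_; _⊔_)
open import Data.Nat.Combinatorics using (_C_)
import Data.Nat.Properties as ℕ
open import Data.Product.Base using (∃; _×_; _,_)
open import Data.Product.Properties using (≡-dec)
open import Data.Rational.Base as ℚ using (ℚ; 0ℚ; 1ℚ; ½; ∣_∣)
import Data.Rational.Properties as ℚ
open import Data.Rational.Solver using (module +-*-Solver)
open import Data.Sum.Base using (_⊎_)
open import Level using (0ℓ)
open import Relation.Binary.PropositionalEquality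
  using (_≡_; refl; sym; trans; cong; subst)
open import Relation.Nullary.Decidable using (Dec; does; ¬?; _×-dec_; _⊎-dec_)
open import Relation.Nullary.Negation using (¬_)

-- A partial equivalence relation: s ∼ s says that s is Cauchy, and for
-- Cauchy s and t, s ∼ t says that s - t tends to 0.

record _∼_ (s t : ℕ → ℚ) : Set where
  constructor mk∼
  field
    within : ∀ ε → 0ℚ ℚ.< ε →
             ∃ λ N → ∀ m n → N ℕ.≤ m → N ℕ.≤ n → ∣ s m ℚ.- t n ∣ ℚ.< ε

open _∼_

record ℝ : Set where
  constructor mkℝ
  field
    seq    : ℕ → ℚ
    cauchy : seq ∼ seq

open ℝ

infix 4 _≃_

record _≃_ (x y : ℝ) : Set where
  constructor mk≃
  field
    seq∼ : seq x ∼ seq y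

open _≃_

private
  0<½* : ∀ {ε} → 0ℚ ℚ.< ε → 0ℚ ℚ.< ½ ℚ.* ε
  0<½* 0<ε = ℚ.*-monoʳ-<-pos ½ 0<ε

  ½ε+½ε≡ε : ∀ ε → ½ ℚ.* ε ℚ.+ ½ ℚ.* ε ≡ ε
  ½ε+½ε≡ε = solve 1 (λ e → con ½ :* e :+ con ½ :* e := e) refl
    where open +-*-Solver

  ∣p-q∣≡∣q-p∣ : ∀ p q → ∣ p ℚ.- q ∣ ≡ ∣ q ℚ.- p ∣
  ∣p-q∣≡∣q-p∣ p q = trans (sym (ℚ.∣-p∣≡∣p∣ (p ℚ.- q)))
    (cong ∣_∣ (solve 2 (λ p q → :- (p :- q) := q :- p) refl p q))
    where open +-*-Solver

  half-bound : ∀ {p q r ε} → r ≡ p ℚ.+ q →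
               ∣ p ∣ ℚ.< ½ ℚ.* ε → ∣ q ∣ ℚ.< ½ ℚ.* ε → ∣ r ∣ ℚ.< ε
  half-bound {p} {q} {ε = ε} refl p< q< = ℚ.≤-<-trans (ℚ.∣p+q∣≤∣p∣+∣q∣ p q)
    (subst (∣ p ∣ ℚ.+ ∣ q ∣ ℚ.<_) (½ε+½ε≡ε ε) (ℚ.+-mono-< p< q<))

  ∣p∣<∣q∣+1 : ∀ p q → ∣ p ℚ.- q ∣ ℚ.< 1ℚ → ∣ p ∣ ℚ.< ∣ q ∣ ℚ.+ 1ℚ
  ∣p∣<∣q∣+1 p q p-q<1 = ℚ.≤-<-trans
    (subst (λ r → ∣ r ∣ ℚ.≤ ∣ q ∣ ℚ.+ ∣ p ℚ.- q ∣)
      (solve 2 (λ p q → q :+ (p :- q) := p) refl p q)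
      (ℚ.∣p+q∣≤∣p∣+∣q∣ q (p ℚ.- q)))
    (ℚ.+-monoʳ-< ∣ q ∣ p-q<1)
    where open +-*-Solver

  scale-bound : ∀ {B B⁻¹ p q ε} → ℚ.Positive B → B ℚ.* B⁻¹ ≡ 1ℚ →
                ∣ p ∣ ℚ.≤ B → ∣ q ∣ ℚ.< B⁻¹ ℚ.* ε → ∣ p ℚ.* q ∣ ℚ.< ε
  scale-bound {B} {B⁻¹} {p} {q} {ε} B>0 inv p≤ q< = begin-strict
    ∣ p ℚ.* q ∣          ≡⟨ ℚ.∣p*q∣≡∣p∣*∣q∣ p q ⟩
    ∣ p ∣ ℚ.* ∣ q ∣      ≤⟨ ℚ.*-monoʳ-≤-nonNeg ∣ q ∣ {{ℚ.∣-∣-nonNeg q}} p≤ ⟩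
    B ℚ.* ∣ q ∣          <⟨ ℚ.*-monoʳ-<-pos B {{B>0}} q< ⟩
    B ℚ.* (B⁻¹ ℚ.* ε)    ≡⟨ sym (ℚ.*-assoc B B⁻¹ ε) ⟩
    (B ℚ.* B⁻¹) ℚ.* ε    ≡⟨ cong (ℚ._* ε) inv ⟩
    1ℚ ℚ.* ε             ≡⟨ ℚ.*-identityˡ ε ⟩
    ε                    ∎
    where open ℚ.≤-Reasoning

  scale-pos : ∀ p {q} → ℚ.Positive p → 0ℚ ℚ.< q → 0ℚ ℚ.< p ℚ.* q
  scale-pos p {q} p>0 0<q =
    subst (ℚ._< p ℚ.* q) (ℚ.*-zeroʳ p) (ℚ.*-monoʳ-<-pos p {{p>0}} 0<q)

  ∼-sym : ∀ {s t} → s ∼ t → t ∼ s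
  ∼-sym {s} {t} p .within ε 0<ε with within p ε 0<ε
  ... | N , b = N , λ m n N≤m N≤n →
    subst (ℚ._< ε) (∣p-q∣≡∣q-p∣ (s n) (t m)) (b n m N≤n N≤m)

  ∼-trans : ∀ {s t u} → s ∼ t → t ∼ u → s ∼ u
  ∼-trans {s} {t} {u} p q .within ε 0<ε
    with within p (½ ℚ.* ε) (0<½* 0<ε) | within q (½ ℚ.* ε) (0<½* 0<ε)
  ... | M , b | N , c = M ⊔ N , λ m n ≤m ≤n →
    half-bound {s m ℚ.- t m} {t m ℚ.- u n}
      (solve 3 (λ a b c → a :- c := (a :- b) :+ (b :- c)) refl (s m) (t m) (u n))
      (b m m (ℕ.m⊔n≤o⇒m≤o M N ≤m) (ℕ.m⊔n≤o⇒m≤o M N ≤m))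
      (c m n (ℕ.m⊔n≤o⇒n≤o M N ≤m) (ℕ.m⊔n≤o⇒n≤o M N ≤n))
    where open +-*-Solver

  ∼-+ : ∀ {s s′ t t′} → s ∼ s′ → t ∼ t′ →
        (λ n → s n ℚ.+ t n) ∼ (λ n → s′ n ℚ.+ t′ n)
  ∼-+ {s} {s′} {t} {t′} p q .within ε 0<ε
    with within p (½ ℚ.* ε) (0<½* 0<ε) | within q (½ ℚ.* ε) (0<½* 0<ε)
  ... | M , b | N , c = M ⊔ N , λ m n ≤m ≤n →
    half-bound {s m ℚ.- s′ n} {t m ℚ.- t′ n}
      (solve 4 (λ a a′ b b′ → (a :+ b) :- (a′ :+ b′) := (a :- a′) :+ (b :- b′))
        refl (s m) (s′ n) (t m) (t′ n))
      (b m n (ℕ.m⊔n≤o⇒m≤o M N ≤m) (ℕ.m⊔n≤o⇒m≤o M N ≤n))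
      (c m n (ℕ.m⊔n≤o⇒n≤o M N ≤m) (ℕ.m⊔n≤o⇒n≤o M N ≤n))
    where open +-*-Solver

  ∼-neg : ∀ {s s′} → s ∼ s′ → (λ n → ℚ.- s n) ∼ (λ n → ℚ.- s′ n)
  ∼-neg {s} {s′} p .within ε 0<ε with within p ε 0<ε
  ... | N , b = N , λ m n N≤m N≤n →
    subst (ℚ._< ε)
      (trans (∣p-q∣≡∣q-p∣ (s m) (s′ n))
        (cong ∣_∣ (solve 2 (λ a a′ → a′ :- a := (:- a) :- (:- a′)) refl (s m) (s′ n))))
      (b m n N≤m N≤n)
    where open +-*-Solver

  record Bounded (s : ℕ → ℚ) : Set where
    field
      B B⁻¹   : ℚ
      B>0     : ℚ.Positive B
      B⁻¹>0   : ℚ.Positive B⁻¹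
      inverse : B ℚ.* B⁻¹ ≡ 1ℚ
      from    : ℕ
      bound   : ∀ m → from ℕ.≤ m → ∣ s m ∣ ℚ.≤ B

  boundedBy : ∀ {s} B → ℚ.Positive B → ∀ N → (∀ m → N ℕ.≤ m → ∣ s m ∣ ℚ.≤ B) →
              Bounded s
  boundedBy B B>0 N b = record
    { B = B
    ; B⁻¹ = ℚ.1/_ B {{B≢0}}
    ; B>0 = B>0
    ; B⁻¹>0 = ℚ.1/pos⇒pos B {{B>0}}
    ; inverse = ℚ.*-inverseʳ B {{B≢0}}
    ; from = N
    ; bound = b
    }
    where
    B≢0 = ℚ.pos⇒nonZero B {{B>0}}

  bounded : ∀ {s s′} → s ∼ s′ → Bounded s
  bounded {s} {s′} p with within p 1ℚ (ℚ.positive⁻¹ 1ℚ)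
  ... | N , b = boundedBy (∣ s′ N ∣ ℚ.+ 1ℚ)
    (ℚ.positive (ℚ.+-mono-≤-< (ℚ.0≤∣p∣ (s′ N)) (ℚ.positive⁻¹ 1ℚ)))
    N
    (λ m N≤m → ℚ.<⇒≤ (∣p∣<∣q∣+1 (s m) (s′ N) (b m N N≤m ℕ.≤-refl)))

  ∼-*-bounded : ∀ {s s′ t t′} → Bounded s → Bounded t′ → s ∼ s′ → t ∼ t′ →
                (λ n → s n ℚ.* t n) ∼ (λ n → s′ n ℚ.* t′ n)
  ∼-*-bounded {s} {s′} {t} {t′} S T p q .within ε 0<ε
    with within p (T.B⁻¹ ℚ.* (½ ℚ.* ε)) (scale-pos T.B⁻¹ {½ ℚ.* ε} T.B⁻¹>0 (0<½* 0<ε))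
       | within q (S.B⁻¹ ℚ.* (½ ℚ.* ε)) (scale-pos S.B⁻¹ {½ ℚ.* ε} S.B⁻¹>0 (0<½* 0<ε))
    where
    module S = Bounded S
    module T = Bounded T
  ... | M , b | N , c = (S.from ⊔ T.from) ⊔ (M ⊔ N) , λ m n ≤m ≤n →
    let ST≤ : ∀ {o} → (S.from ⊔ T.from) ⊔ (M ⊔ N) ℕ.≤ o → S.from ⊔ T.from ℕ.≤ o
        ST≤ = ℕ.m⊔n≤o⇒m≤o (S.from ⊔ T.from) (M ⊔ N)
        MN≤ : ∀ {o} → (S.from ⊔ T.from) ⊔ (M ⊔ N) ℕ.≤ o → M ⊔ N ℕ.≤ o
        MN≤ = ℕ.m⊔n≤o⇒n≤o (S.from ⊔ T.from) (M ⊔ N)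
    in half-bound {s m ℚ.* (t m ℚ.- t′ n)} {t′ n ℚ.* (s m ℚ.- s′ n)}
      (solve 4 (λ a a′ b b′ →
          a :* b :- a′ :* b′ := a :* (b :- b′) :+ b′ :* (a :- a′))
        refl (s m) (s′ n) (t m) (t′ n))
      (scale-bound {S.B} {S.B⁻¹} {s m} S.B>0 S.inverse
        (S.bound m (ℕ.m⊔n≤o⇒m≤o S.from T.from (ST≤ ≤m)))
        (c m n (ℕ.m⊔n≤o⇒n≤o M N (MN≤ ≤m)) (ℕ.m⊔n≤o⇒n≤o M N (MN≤ ≤n))))
      (scale-bound {T.B} {T.B⁻¹} {t′ n} T.B>0 T.inverse
        (T.bound n (ℕ.m⊔n≤o⇒n≤o S.from T.from (ST≤ ≤n)))
        (b m n (ℕ.m⊔n≤o⇒m≤o M N (MN≤ ≤m)) (ℕ.m⊔n≤o⇒m≤o M N (MN≤ ≤n))))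
    where
    open +-*-Solver
    module S = Bounded S
    module T = Bounded T

  ∼-* : ∀ {s s′ t t′} → s ∼ s′ → t ∼ t′ →
        (λ n → s n ℚ.* t n) ∼ (λ n → s′ n ℚ.* t′ n)
  ∼-* p q = ∼-*-bounded (bounded p) (bounded (∼-sym q)) p q

  ∼-const : ∀ q → (λ _ → q) ∼ (λ _ → q)
  ∼-const q .within ε 0<ε = 0 , λ _ _ _ _ →
    subst (λ r → ∣ r ∣ ℚ.< ε) (sym (ℚ.+-inverseʳ q)) 0<ε

ratℝ : ℚ → ℝ
ratℝ q = mkℝ (λ _ → q) (∼-const q)

infixl 6 _+ʳ_
infixl 7 _*ʳ_
infix  8 -ʳ_

_+ʳ_ _*ʳ_ : ℝ → ℝ → ℝ
x +ʳ y = mkℝ (λ n → seq x n ℚ.+ seq y n) (∼-+ (cauchy x) (cauchy y))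
x *ʳ y = mkℝ (λ n → seq x n ℚ.* seq y n) (∼-* (cauchy x) (cauchy y))

-ʳ_ : ℝ → ℝ
-ʳ x = mkℝ (λ n → ℚ.- seq x n) (∼-neg (cauchy x))

private
  pointwise : ∀ {x y} → (∀ n → seq x n ≡ seq y n) → x ≃ y
  pointwise {x} x≡y .seq∼ .within ε 0<ε with within (cauchy x) ε 0<ε
  ... | N , b = N , λ m n N≤m N≤n →
    subst (λ r → ∣ seq x m ℚ.- r ∣ ℚ.< ε) (x≡y n) (b m n N≤m N≤n)

ℝ-commutativeRing : CommutativeRing 0ℓ 0ℓ
ℝ-commutativeRing = record
  { Carrier = ℝ
  ; _≈_ = _≃_
  ; _+_ = _+ʳ_
  ; _*_ = _*ʳ_
  ; -_ = -ʳ_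
  ; 0# = ratℝ 0ℚ
  ; 1# = ratℝ 1ℚ
  ; isCommutativeRing = record
    { isRing = record
      { +-isAbelianGroup = record
        { isGroup = record
          { isMonoid = record
            { isSemigroup = record
              { isMagma = record
                { isEquivalence = record
                  { refl = λ {x} → mk≃ (cauchy x)
                  ; sym = λ p → mk≃ (∼-sym (seq∼ p))
                  ; trans = λ p q → mk≃ (∼-trans (seq∼ p) (seq∼ q))
                  }
                ; ∙-cong = λ p q → mk≃ (∼-+ (seq∼ p) (seq∼ q))
                }
              ; assoc = λ x y z → pointwise λ n → ℚ.+-assoc (seq x n) (seq y n) (seq z n)
              }
            ; identity = (λ x → pointwise λ n → ℚ.+-identityˡ (seq x n))
                       , (λ x → pointwise λ n → ℚ.+-identityʳ (seq x n))
            }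
          ; inverse = (λ x → pointwise λ n → ℚ.+-inverseˡ (seq x n))
                    , (λ x → pointwise λ n → ℚ.+-inverseʳ (seq x n))
          ; ⁻¹-cong = λ p → mk≃ (∼-neg (seq∼ p))
          }
        ; comm = λ x y → pointwise λ n → ℚ.+-comm (seq x n) (seq y n)
        }
      ; *-cong = λ p q → mk≃ (∼-* (seq∼ p) (seq∼ q))
      ; *-assoc = λ x y z → pointwise λ n → ℚ.*-assoc (seq x n) (seq y n) (seq z n)
      ; *-identity = (λ x → pointwise λ n → ℚ.*-identityˡ (seq x n))
                   , (λ x → pointwise λ n → ℚ.*-identityʳ (seq x n))
      ; distrib =
          (λ x y z → pointwise λ n → ℚ.*-distribˡ-+ (seq x n) (seq y n) (seq z n))
        , (λ x y z → pointwise λ n → ℚ.*-distribʳ-+ (seq x n) (seq y n) (seq z n))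
      }
    ; *-comm = λ x y → pointwise λ n → ℚ.*-comm (seq x n) (seq y n)
    }
  }

module AdjoinI {c ℓ} (R : CommutativeRing c ℓ) where

  private
    module R = CommutativeRing R

    -x≈-1*x : ∀ x → R.- x R.≈ R.- R.1# R.* x
    -x≈-1*x x = R.sym (RingProperties.-1*x≈-x R.ring x)

    open NatSolver R.commutativeSemiring using (solve; _:+_; _:*_; _:=_)

  record Carrier : Set c where
    constructor _+i_
    field
      re im : R.Carrier

  open Carrier

  infix 4 _≈_

  record _≈_ (z w : Carrier) : Set ℓ where
    constructor mk≈
    field
      re≈ : re z R.≈ re w
      im≈ : im z R.≈ im w

  open _≈_

  fromReal : R.Carrier → Carrier
  fromReal x = x +i R.0#

  infixl 6 _+_
  infixl 7 _*_
  infix  8 -_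

  _+_ _*_ : Carrier → Carrier → Carrier
  (a +i b) + (c +i d) = (a R.+ c) +i (b R.+ d)
  (a +i b) * (c +i d) = (a R.* c R.- b R.* d) +i (a R.* d R.+ b R.* c)

  -_ : Carrier → Carrier
  - (a +i b) = (R.- a) +i (R.- b)

  private
    *-cong : ∀ {x y u v} → x ≈ y → u ≈ v → (x * u) ≈ (y * v)
    *-cong (mk≈ p q) (mk≈ r s) = mk≈
      (R.+-cong (R.*-cong p r) (R.-‿cong (R.*-cong q s)))
      (R.+-cong (R.*-cong p s) (R.*-cong q r))

    *-assoc : ∀ x y z → ((x * y) * z) ≈ (x * (y * z))
    *-assoc (a +i b) (c +i d) (e +i f) = mk≈ (re-eq a b c d e f) (im-eq a b c d e f)
      where
      re-eq : ∀ a b c d e f →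
              (a R.* c R.- b R.* d) R.* e R.- (a R.* d R.+ b R.* c) R.* f R.≈
              a R.* (c R.* e R.- d R.* f) R.- b R.* (c R.* f R.+ d R.* e)
      re-eq a b c d e f = R.trans
        (R.+-cong (R.*-congʳ (R.+-congˡ (-x≈-1*x _))) (-x≈-1*x _))
        (R.trans
          (solve 7 (λ m a b c d e f →
              (a :* c :+ m :* (b :* d)) :* e :+ m :* ((a :* d :+ b :* c) :* f) :=
              a :* (c :* e :+ m :* (d :* f)) :+ m :* (b :* (c :* f :+ d :* e)))
            R.refl (R.- R.1#) a b c d e f)
          (R.sym (R.+-cong (R.*-congˡ (R.+-congˡ (-x≈-1*x _))) (-x≈-1*x _))))
      im-eq : ∀ a b c d e f →
              (a R.* c R.- b R.* d) R.* f R.+ (a R.* d R.+ b R.* c) R.* e R.≈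
              a R.* (c R.* f R.+ d R.* e) R.+ b R.* (c R.* e R.- d R.* f)
      im-eq a b c d e f = R.trans
        (R.+-congʳ (R.*-congʳ (R.+-congˡ (-x≈-1*x _))))
        (R.trans
          (solve 7 (λ m a b c d e f →
              (a :* c :+ m :* (b :* d)) :* f :+ (a :* d :+ b :* c) :* e :=
              a :* (c :* f :+ d :* e) :+ b :* (c :* e :+ m :* (d :* f)))
            R.refl (R.- R.1#) a b c d e f)
          (R.sym (R.+-congˡ (R.*-congˡ (R.+-congˡ (-x≈-1*x _))))))

    *-comm : ∀ x y → (x * y) ≈ (y * x)
    *-comm (a +i b) (c +i d) = mk≈
      (R.+-cong (R.*-comm a c) (R.-‿cong (R.*-comm b d)))
      (R.trans (R.+-cong (R.*-comm a d) (R.*-comm b c)) (R.+-comm (d R.* a) (c R.* b)))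

    *-identityˡ : ∀ x → (fromReal R.1# * x) ≈ x
    *-identityˡ (a +i b) = mk≈
      (R.trans (R.+-cong (R.*-identityˡ a) (R.trans (R.-‿cong (R.zeroˡ b)) -0≈0))
               (R.+-identityʳ a))
      (R.trans (R.+-cong (R.*-identityˡ b) (R.zeroˡ a)) (R.+-identityʳ b))
      where
      -0≈0 : R.- R.0# R.≈ R.0#
      -0≈0 = R.trans (R.sym (R.+-identityˡ (R.- R.0#))) (R.-‿inverseʳ R.0#)

    distribˡ : ∀ x y z → (x * (y + z)) ≈ ((x * y) + (x * z))
    distribˡ (a +i b) (c +i d) (e +i f) = mk≈ (re-eq a b c d e f) (im-eq a b c d e f)
      where
      re-eq : ∀ a b c d e f →
              a R.* (c R.+ e) R.- b R.* (d R.+ f) R.≈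
              (a R.* c R.- b R.* d) R.+ (a R.* e R.- b R.* f)
      re-eq a b c d e f = R.trans
        (R.+-congˡ (-x≈-1*x _))
        (R.trans
          (solve 7 (λ m a b c d e f →
              a :* (c :+ e) :+ m :* (b :* (d :+ f)) :=
              (a :* c :+ m :* (b :* d)) :+ (a :* e :+ m :* (b :* f)))
            R.refl (R.- R.1#) a b c d e f)
          (R.sym (R.+-cong (R.+-congˡ (-x≈-1*x _)) (R.+-congˡ (-x≈-1*x _)))))
      im-eq : ∀ a b c d e f →
              a R.* (d R.+ f) R.+ b R.* (c R.+ e) R.≈
              (a R.* d R.+ b R.* c) R.+ (a R.* f R.+ b R.* e)
      im-eq = solve 6 (λ a b c d e f →
          a :* (d :+ f) :+ b :* (c :+ e) :=
          (a :* d :+ b :* c) :+ (a :* f :+ b :* e))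
        R.refl

    ≈-trans : ∀ {x y z} → x ≈ y → y ≈ z → x ≈ z
    ≈-trans (mk≈ p q) (mk≈ r s) = mk≈ (R.trans p r) (R.trans q s)

    +-cong : ∀ {x y u v} → x ≈ y → u ≈ v → (x + u) ≈ (y + v)
    +-cong (mk≈ p q) (mk≈ r s) = mk≈ (R.+-cong p r) (R.+-cong q s)

  commutativeRing : CommutativeRing c ℓ
  commutativeRing = record
    { Carrier = Carrier
    ; _≈_ = _≈_
    ; _+_ = _+_
    ; _*_ = _*_
    ; -_ = -_
    ; 0# = fromReal R.0#
    ; 1# = fromReal R.1#
    ; isCommutativeRing = record
      { isRing = record
        { +-isAbelianGroup = record
          { isGroup = record
            { isMonoid = record
              { isSemigroup = record
                { isMagma = record
                  { isEquivalence = record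
                    { refl = mk≈ R.refl R.refl
                    ; sym = λ p → mk≈ (R.sym (re≈ p)) (R.sym (im≈ p))
                    ; trans = ≈-trans
                    }
                  ; ∙-cong = +-cong
                  }
                ; assoc = λ x y z → mk≈ (R.+-assoc _ _ _) (R.+-assoc _ _ _)
                }
              ; identity = (λ x → mk≈ (R.+-identityˡ _) (R.+-identityˡ _))
                         , (λ x → mk≈ (R.+-identityʳ _) (R.+-identityʳ _))
              }
            ; inverse = (λ x → mk≈ (R.-‿inverseˡ _) (R.-‿inverseˡ _))
                      , (λ x → mk≈ (R.-‿inverseʳ _) (R.-‿inverseʳ _))
            ; ⁻¹-cong = λ p → mk≈ (R.-‿cong (re≈ p)) (R.-‿cong (im≈ p))
            }
          ; comm = λ x y → mk≈ (R.+-comm _ _) (R.+-comm _ _)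
          }
        ; *-cong = *-cong
        ; *-assoc = *-assoc
        ; *-identity = *-identityˡ
                     , (λ x → ≈-trans (*-comm x (fromReal R.1#)) (*-identityˡ x))
        ; distrib = distribˡ
                  , (λ x y z → ≈-trans (*-comm (y + z) x)
                      (≈-trans (distribˡ x y z) (+-cong (*-comm x y) (*-comm x z))))
        }
      ; *-comm = *-comm
      }
    }

ℂ-commutativeRing : CommutativeRing 0ℓ 0ℓ
ℂ-commutativeRing = AdjoinI.commutativeRing ℝ-commutativeRing

open CommutativeRing ℂ-commutativeRing public
  using (_≈_; _+_; _*_; -_; _-_) renaming (Carrier to ℂ)
open CommutativeRing ℂ-commutativeRing using (0#; semiring)
open Exp semiring public using (_^_)

fromℚ : ℚ → ℂ
fromℚ q = AdjoinI.fromReal ℝ-commutativeRing (ratℝ q)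

fromℕ : ℕ → ℂ
fromℕ k = fromℚ (+ k ℚ./ 1)

-- Totalised: division by 0 gives 0. Every divisor used below is nonzero
-- for n ≥ 4.

infixl 7 _÷_

_÷_ : ℂ → ℕ → ℂ
z ÷ zero  = 0#
z ÷ suc d = z * fromℚ (+ 1 ℚ./ suc d)

sum : List ℂ → ℂ
sum = foldr _+_ 0#

-- The vertex v_{n,i} is represented by i - 1 : Fin n, and a chord by its
-- pair of endpoints, smaller one first.

Chord : ℕ → Set
Chord n = Fin n × Fin n

IsSide : ∀ {n} → Chord n → Set
IsSide {n} (i , k) = toℕ k ≡ suc (toℕ i) ⊎ (toℕ i ≡ 0 × suc (toℕ k) ≡ n)

isSide? : ∀ {n} (e : Chord n) → Dec (IsSide e)
isSide? {n} (i , k) =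
  (toℕ k ℕ.≟ suc (toℕ i)) ⊎-dec ((toℕ i ℕ.≟ 0) ×-dec (suc (toℕ k) ℕ.≟ n))

IsDiagonal : ∀ {n} → Chord n → Set
IsDiagonal (i , k) = i Fin.< k × ¬ IsSide (i , k)

isDiagonal? : ∀ {n} (e : Chord n) → Dec (IsDiagonal e)
isDiagonal? (i , k) = (i Fin.<? k) ×-dec ¬? (isSide? (i , k))

diagonals : ∀ n → List (Chord n)
diagonals n = filter isDiagonal? (cartesianProduct (allFin n) (allFin n))

-- By convexity, two diagonals meet in the interior of the polygon exactly
-- when their endpoints interleave.

Crossing : ∀ {n} → Chord n → Chord n → Set
Crossing (a , b) (c , d) =
  (a Fin.< c × c Fin.< b × b Fin.< d) ⊎ (c Fin.< a × a Fin.< d × d Fin.< b)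

crossing? : ∀ {n} (e e′ : Chord n) → Dec (Crossing e e′)
crossing? (a , b) (c , d) =
  ((a Fin.<? c) ×-dec (c Fin.<? b) ×-dec (b Fin.<? d)) ⊎-dec
  ((c Fin.<? a) ×-dec (a Fin.<? d) ×-dec (d Fin.<? b))

Edge : ∀ {n} → List (Chord n) → Chord n → Set
Edge T e = IsSide e ⊎ e ∈ T

edge? : ∀ {n} (T : List (Chord n)) (e : Chord n) → Dec (Edge T e)
edge? T e = isSide? e ⊎-dec (e ∈? T)
  where open DecMembership (≡-dec Fin._≟_ Fin._≟_) using (_∈?_)

Triple : ℕ → Set
Triple n = Fin n × Fin n × Fin n

triples : ∀ n → List (Triple n)
triples n = filter (λ (l , j , r) → (l Fin.<? j) ×-dec (j Fin.<? r))
  (cartesianProduct (allFin n) (cartesianProduct (allFin n) (allFin n)))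

-- A noncrossing set T has no diagonal entering a triangle whose three
-- sides are edges of T, so these triangles are the triangular pieces
-- into which T cuts the polygon.

TriangleOf : ∀ {n} → List (Chord n) → Triple n → Set
TriangleOf T (l , j , r) = Edge T (l , j) × Edge T (j , r) × Edge T (l , r)

triangleOf? : ∀ {n} (T : List (Chord n)) (t : Triple n) → Dec (TriangleOf T t)
triangleOf? T (l , j , r) =
  edge? T (l , j) ×-dec edge? T (j , r) ×-dec edge? T (l , r)

triangles : ∀ {n} → List (Chord n) → List (Triple n)
triangles {n} T = filter (triangleOf? T) (triples n)

IsTriangulation : ∀ {n} → List (Chord n) → Set
IsTriangulation {n} T =
  length T ≡ n ∸ 3 ×
  AllPairs (λ e e′ → ¬ Crossing e e′) T ×
  length (triangles T) ≡ n ∸ 2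

isTriangulation? : ∀ {n} (T : List (Chord n)) → Dec (IsTriangulation T)
isTriangulation? {n} T =
  (length T ℕ.≟ n ∸ 3) ×-dec
  allPairs? (λ e e′ → ¬? (crossing? e e′)) T ×-dec
  (length (triangles T) ℕ.≟ n ∸ 2)

sublists : ∀ {a} {A : Set a} → List A → List (List A)
sublists []       = [] ∷ []
sublists (x ∷ xs) = map (x ∷_) (sublists xs) ++ sublists xs

-- A set of diagonals is a sublist of the repetition-free list of all of
-- them, so every triangulation is listed exactly once.

triangulations : ∀ n → List (List (Chord n))
triangulations n = filter isTriangulation? (sublists (diagonals n))

commonSides : ∀ {n} → Triple n → ℕ
commonSides (l , j , r) =
  length (filter isSide? ((l , j) ∷ (j , r) ∷ (l , r) ∷ []))

f : ∀ {n} → ℂ → Triple n → ℂ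
f w t@(l , j , r) = if does (commonSides t ℕ.≟ 1)
  then (w ^ (toℕ j ∸ toℕ l) + w ^ (toℕ r ∸ toℕ j)) ÷ 2
  else 0#

𝒮 : ∀ {n} → ℂ → List (Chord n) → ℂ
𝒮 w T = sum (map (f w) (triangles T))

𝔼 : ∀ n → (List (Chord n) → ℂ) → ℂ
𝔼 n X = sum (map X (triangulations n)) ÷ length (triangulations n)

-- The quotient is exact.

catalan : ℕ → ℕ
catalan k = ((2 ℕ.* k) C k) ℕ./ suc k

Σ[0⋯_] : ℕ → (ℕ → ℂ) → ℂ
Σ[0⋯ m ] g = sum (map g (upTo (suc m)))

module Submission where

-- Cutting along the triangle on the base (0, n - 1) identifies the triangulations of the n-gon with
-- the binary trees with n - 2 nodes: every noncrossing set of diagonals extends to a tree (take as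
-- apex the far end of the last edge, other than the base, at the left end of the base), and a set of
-- n - 3 diagonals then consists of all chords of that tree.
-- The weight of the triangle on the base of a proper sub-polygon depends only on the sizes of the two
-- pieces next to it.  Let c be the generating function of the Catalan numbers, s that of the total
-- weights of all trees of a given size, and F that of the contributions of the base triangles.  Then
-- s = x (F + 2 c s), so s = x F b, where b = 1 / (1 - 2 x c) generates the central binomial
-- coefficients.  For the polygon itself the base is a side, so that the base triangle carries weight
-- exactly when it has no other side on the perimeter; adding this case gives the closed form.

open import Algebra.Bundles using (CommutativeSemiring; CommutativeRing)
import Algebra.Properties.CommutativeSemigroup as CSG
import Algebra.Properties.Group as GroupProperties
import Algebra.Properties.Semiring.Exp as Exp
import Algebra.Properties.Semiring.Mult.TCOptimised as Mult
import Algebra.Solver.Ring.NaturalCoefficients.Default as NatSolver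
open import Algebra.Structures using (IsCommutativeRing)
open import Data.Bool.Base using (true; false; if_then_else_)
open import Data.Empty using (⊥-elim)
open import Data.Fin.Base as Fin using (Fin; toℕ; fromℕ<)
import Data.Fin.Properties as Fin
open import Data.Integer.Base as ℤ using (+_)
import Data.Integer.Properties as ℤ
open import Data.List.Base as List
  using (List; []; _∷_; _++_; map; length; filter; cartesianProductWith; foldr; applyUpTo;
    upTo; allFin; cartesianProduct)
import Data.List.Membership.DecPropositional as DecMembership
open import Data.List.Membership.Propositional using (_∈_)
open import Data.List.Membership.Propositional.Properties
  using (∈-++⁺ˡ; ∈-++⁺ʳ; ∈-++⁻; ∈-map⁺; ∈-map⁻; ∈-∃++; ∈-cartesianProductWith⁺;
    ∈-cartesianProductWith⁻; ∈-filter⁺; ∈-filter⁻; ∈-allFin; ∈-cartesianProduct⁺)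
import Data.List.Properties as List
open import Data.List.Relation.Binary.Permutation.Propositional as ↭
  using (_↭_; ↭-refl; ↭-sym; ↭-trans; ↭-prep)
open import Data.List.Relation.Binary.Permutation.Propositional.Properties as ↭
  using (shift; ∈-resp-↭; ↭-length)
open import Data.List.Relation.Binary.Subset.Propositional using (_⊆_)
open import Data.List.Relation.Unary.All as All using (All; []; _∷_)
open import Data.List.Relation.Unary.AllPairs as AllPairs using (AllPairs; []; _∷_)
open import Data.List.Relation.Unary.Any using (here; there)
open import Data.List.Relation.Unary.Unique.Propositional using (Unique)
import Data.List.Relation.Unary.Unique.Propositional.Properties as Unique
open import Data.Nat.Base as ℕ using (ℕ; zero; suc; _≤_; _∸_; z≤n; s≤s; _<_)
open import Data.Nat.Combinatorics using (_C_; nCk≡nC[n∸k]; nC1≡n; nCn≡1; nCk+nC[k+1]≡[n+1]C[k+1])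
open import Data.Nat.Coprimality using (1-coprimeTo) renaming (sym to coprime-sym)
open import Data.Nat.DivMod using (m*[n/m]≡n)
open import Data.Nat.Divisibility using (divides)
import Data.Nat.Properties as ℕ
open import Data.Nat.Solver using (module +-*-Solver)
open import Data.Product.Base using (∃; ∃₂; _×_; _,_; proj₁; proj₂)
open import Data.Product.Properties using (≡-dec)
open import Data.Rational.Base as ℚ using (ℚ; 0ℚ; 1ℚ; mkℚ)
import Data.Rational.Properties as ℚ
open import Data.Sum.Base using (_⊎_; inj₁; inj₂; [_,_]′)
open import Function.Base using (_∘_)
open import Function.Bundles using (mk⇔)
open import Level using (Level)
open import Relation.Binary.Core using (Rel)
open import Relation.Binary.PropositionalEquality as ≡ using (_≡_)
import Relation.Binary.Reasoning.Setoid as SetoidReasoning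
open import Relation.Nullary.Decidable
  using (Dec; yes; no; map′; _×-dec_; _⊎-dec_; does; dec-true; dec-false; does-⇔)
open import Relation.Nullary.Negation using (¬_; contradiction)
open import Relation.Unary using (Pred; Decidable)
open import Defs
  using (Chord; Triple; IsSide; isSide?; IsDiagonal; isDiagonal?; diagonals; Crossing; Edge;
    triples; TriangleOf; triangleOf?; triangles; IsTriangulation; isTriangulation?; sublists;
    triangulations; commonSides; catalan)

-- Origin of the constants: put k = n - 3 and let v generate the numbers w^j C_j. Giving weight to
-- every base triangle of the polygon would contribute w (v c), but one with an empty piece carries
-- none, which removes F. The pieces below it contribute 2 c s, the coefficient of s at k + 1 minus
-- F, and that coefficient is w (v b) - w c. So C_k gets the factor -(2 (w^(k+1) + w) + w) = -(2
-- w^(n-2) + 3 w), and C_k / C_(k+1) = (n - 1) / (2 (2n - 5)). The rest, w (v c + v b), becomes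
-- central binomial sums through 2 C_i = 4 B_i - B_(i+1), B_i being the central binomial
-- coefficient; hence the coefficients 3 and -1/2. The algebra works with coefficient sequences over
-- any commutative ring containing a half. Subtracted terms are moved to the other side, so that
-- semiring identities suffice, and reciprocals enter only through their defining equations. Pieces
-- of the polygon sit at offsets in the natural numbers, so that passing to a sub-polygon needs no
-- relabelling.

-- Convolutions over a commutative semiring.

module Antidiagonal {a ℓ} (S : CommutativeSemiring a ℓ) where

  open CommutativeSemiring S
  open SetoidReasoning setoid
  open CSG +-commutativeSemigroup using (interchange; x∙yz≈y∙xz)

  -- Both indices are handed to `φ`, which keeps truncated subtraction out of the convolution
  -- algebra.
  antidiag : (ℕ → ℕ → Carrier) → ℕ → Carrier
  antidiag φ zero    = φ 0 0
  antidiag φ (suc k) = φ 0 (suc k) + antidiag (λ i j → φ (suc i) j) k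

  antidiag-cong : ∀ {φ ψ} k → (∀ i j → i ℕ.+ j ≡ k → φ i j ≈ ψ i j) →
                  antidiag φ k ≈ antidiag ψ k
  antidiag-cong zero    φ≈ψ = φ≈ψ 0 0 ≡.refl
  antidiag-cong (suc k) φ≈ψ = +-cong (φ≈ψ 0 (suc k) ≡.refl)
    (antidiag-cong k λ i j eq → φ≈ψ (suc i) j (≡.cong suc eq))

  antidiag-+ : ∀ φ ψ k →
    antidiag (λ i j → φ i j + ψ i j) k ≈ antidiag φ k + antidiag ψ k
  antidiag-+ φ ψ zero    = refl
  antidiag-+ φ ψ (suc k) =
    trans (+-congˡ (antidiag-+ _ _ k)) (interchange _ _ _ _)

  antidiag-*ˡ : ∀ x φ k → antidiag (λ i j → x * φ i j) k ≈ x * antidiag φ k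
  antidiag-*ˡ x φ zero    = refl
  antidiag-*ˡ x φ (suc k) =
    trans (+-congˡ (antidiag-*ˡ x _ k)) (sym (distribˡ _ _ _))

  antidiag-last : ∀ φ k →
    antidiag φ (suc k) ≈ φ (suc k) 0 + antidiag (λ i j → φ i (suc j)) k
  antidiag-last φ zero    = +-comm _ _
  antidiag-last φ (suc k) =
    trans (+-congˡ (antidiag-last (λ i j → φ (suc i) j) k)) (x∙yz≈y∙xz _ _ _)

  antidiag-swap : ∀ φ k → antidiag φ k ≈ antidiag (λ i j → φ j i) k
  antidiag-swap φ zero    = refl
  antidiag-swap φ (suc k) =
    trans (+-congˡ (antidiag-swap (λ i j → φ (suc i) j) k)) (sym (antidiag-last (λ i j → φ j i) k))

  -- Both sides run over all p + q + j = k. Splitting off the terms with p = 0 leaves the same claim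
  -- for a smaller k and shifted p.
  antidiag-assoc : ∀ (φ : ℕ → ℕ → ℕ → Carrier) k →
    antidiag (λ i j → antidiag (λ p q → φ p q j) i) k ≈
    antidiag (λ p m → antidiag (λ q j → φ p q j) m) k
  antidiag-assoc φ zero    = refl
  antidiag-assoc φ (suc k) = begin
    φ 0 0 (suc k) + antidiag (λ i j → φ 0 (suc i) j + antidiag (λ p q → φ (suc p) q j) i) k
      ≈⟨ +-congˡ (antidiag-+ _ _ k) ⟩
    φ 0 0 (suc k) + (antidiag (λ i j → φ 0 (suc i) j) k + _)
      ≈⟨ +-assoc _ _ _ ⟨
    antidiag (φ 0) (suc k) + _
      ≈⟨ +-congˡ (antidiag-assoc (λ p → φ (suc p)) k) ⟩
    _ ∎

  infixl 7 _⋆_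

  _⋆_ : (ℕ → Carrier) → (ℕ → Carrier) → ℕ → Carrier
  (f ⋆ g) = antidiag (λ i j → f i * g j)

  ⋆-cong : ∀ {f f′ g g′} k → (∀ i → i ≤ k → f i ≈ f′ i) → (∀ i → i ≤ k → g i ≈ g′ i) →
           (f ⋆ g) k ≈ (f′ ⋆ g′) k
  ⋆-cong k f≈ g≈ = antidiag-cong k λ { i j ≡.refl →
    *-cong (f≈ i (ℕ.m≤m+n i j)) (g≈ j (ℕ.m≤n+m j i)) }

  ⋆-comm : ∀ f g k → (f ⋆ g) k ≈ (g ⋆ f) k
  ⋆-comm f g k = trans (antidiag-swap _ k) (antidiag-cong k λ _ _ _ → *-comm _ _)

  ⋆-distribˡ : ∀ f g h k → (f ⋆ (λ i → g i + h i)) k ≈ (f ⋆ g) k + (f ⋆ h) k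
  ⋆-distribˡ f g h k =
    trans (antidiag-cong k λ _ _ _ → distribˡ _ _ _) (antidiag-+ _ _ k)

  ⋆-scaleʳ : ∀ x f g k → (f ⋆ (λ i → x * g i)) k ≈ x * (f ⋆ g) k
  ⋆-scaleʳ x f g k = trans
    (antidiag-cong k λ _ _ _ →
      trans (sym (*-assoc _ _ _)) (trans (*-congʳ (*-comm _ _)) (*-assoc _ _ _)))
    (antidiag-*ˡ x _ k)

  ⋆-assoc : ∀ f g h k → ((f ⋆ g) ⋆ h) k ≈ (f ⋆ (g ⋆ h)) k
  ⋆-assoc f g h k = begin
    antidiag (λ i j → antidiag (λ p q → f p * g q) i * h j) k
      ≈⟨ antidiag-cong k (λ i j _ → trans (*-comm _ _) (trans (sym (antidiag-*ˡ _ _ i))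
           (antidiag-cong i λ p q _ → trans (*-comm _ _) (*-assoc _ _ _)))) ⟩
    antidiag (λ i j → antidiag (λ p q → f p * (g q * h j)) i) k
      ≈⟨ antidiag-assoc (λ p q j → f p * (g q * h j)) k ⟩
    antidiag (λ p m → antidiag (λ q j → f p * (g q * h j)) m) k
      ≈⟨ antidiag-cong k (λ p m _ → antidiag-*ˡ _ _ m) ⟩
    (f ⋆ (g ⋆ h)) k ∎

-- Catalan numbers and central binomial coefficients.

module CatalanNumbers where

  module ℕ-Antidiagonal = Antidiagonal ℕ.+-*-commutativeSemiring

  -- Pascal's rule splits the left side so that two instances with smaller n apply, and a second use
  -- of the rule recombines them.
  [k+1]*[n+1]C[k+1]≡[n+1]*nCk : ∀ n k → suc k ℕ.* (suc n C suc k) ≡ suc n ℕ.* (n C k)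
  [k+1]*[n+1]C[k+1]≡[n+1]*nCk zero    zero    = ≡.refl
  [k+1]*[n+1]C[k+1]≡[n+1]*nCk zero    (suc k) = ℕ.*-zeroʳ (suc (suc k))
  [k+1]*[n+1]C[k+1]≡[n+1]*nCk (suc n) zero    = begin
    1 ℕ.* (suc (suc n) C 1) ≡⟨ ℕ.*-identityˡ _ ⟩
    suc (suc n) C 1         ≡⟨ nC1≡n (suc (suc n)) ⟩
    suc (suc n)             ≡⟨ ℕ.*-identityʳ _ ⟨
    suc (suc n) ℕ.* 1       ≡⟨ ≡.cong (suc (suc n) ℕ.*_) (≡.trans (nCk≡nC[n∸k] {0} {suc n} z≤n) (nCn≡1 (suc n))) ⟨
    suc (suc n) ℕ.* (suc n C 0) ∎
    where open ≡.≡-Reasoning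
  [k+1]*[n+1]C[k+1]≡[n+1]*nCk (suc n) (suc k) = begin
    suc (suc k) ℕ.* (suc (suc n) C suc (suc k))
      ≡⟨ ≡.cong (suc (suc k) ℕ.*_) (nCk+nC[k+1]≡[n+1]C[k+1] (suc n) (suc k)) ⟨
    suc (suc k) ℕ.* (x ℕ.+ y)
      ≡⟨ solve 3 (λ k x y → (con 2 :+ k) :* (x :+ y) :=
           x :+ ((con 1 :+ k) :* x :+ (con 2 :+ k) :* y)) ≡.refl k x y ⟩
    x ℕ.+ (suc k ℕ.* x ℕ.+ suc (suc k) ℕ.* y)
      ≡⟨ ≡.cong (x ℕ.+_) (≡.cong₂ ℕ._+_ ([k+1]*[n+1]C[k+1]≡[n+1]*nCk n k)
           ([k+1]*[n+1]C[k+1]≡[n+1]*nCk n (suc k))) ⟩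
    x ℕ.+ (suc n ℕ.* (n C k) ℕ.+ suc n ℕ.* (n C suc k))
      ≡⟨ ≡.cong (x ℕ.+_) (ℕ.*-distribˡ-+ (suc n) (n C k) (n C suc k)) ⟨
    x ℕ.+ suc n ℕ.* (n C k ℕ.+ n C suc k)
      ≡⟨ ≡.cong (λ z → x ℕ.+ suc n ℕ.* z) (nCk+nC[k+1]≡[n+1]C[k+1] n k) ⟩
    suc (suc n) ℕ.* x ∎
    where
    open ≡.≡-Reasoning
    open +-*-Solver
    x = suc n C suc k
    y = suc n C suc (suc k)

  central : ℕ → ℕ
  central k = (2 ℕ.* k) C k

  -- `catalan` is an integer quotient, so exactness has to be shown. The witness is the ballot
  -- difference of the middle binomial coefficient of row 2k and its right neighbour.
  [k+1]*catalan≡central : ∀ k → suc k ℕ.* catalan k ≡ central k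
  [k+1]*catalan≡central k = m*[n/m]≡n (divides q (≡.trans exact (ℕ.*-comm (suc k) q)))
    where
    open ≡.≡-Reasoning
    B = central k
    D = (2 ℕ.* k) C suc k
    q = B ∸ D
    open +-*-Solver
    k*B≡[k+1]*D : k ℕ.* B ≡ suc k ℕ.* D
    k*B≡[k+1]*D = ℕ.+-cancelˡ-≡ (suc k ℕ.* B) _ _ (begin
      suc k ℕ.* B ℕ.+ k ℕ.* B
        ≡⟨ solve 2 (λ k B → (con 1 :+ k) :* B :+ k :* B := (con 1 :+ con 2 :* k) :* B) ≡.refl k B ⟩
      suc (2 ℕ.* k) ℕ.* B
        ≡⟨ [k+1]*[n+1]C[k+1]≡[n+1]*nCk (2 ℕ.* k) k ⟨
      suc k ℕ.* (suc (2 ℕ.* k) C suc k)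
        ≡⟨ ≡.cong (suc k ℕ.*_) (nCk+nC[k+1]≡[n+1]C[k+1] (2 ℕ.* k) k) ⟨
      suc k ℕ.* (B ℕ.+ D)
        ≡⟨ ℕ.*-distribˡ-+ (suc k) B D ⟩
      suc k ℕ.* B ℕ.+ suc k ℕ.* D ∎)
    exact : B ≡ suc k ℕ.* q
    exact = begin
      B                              ≡⟨ ℕ.m+n∸n≡m B (k ℕ.* B) ⟨
      suc k ℕ.* B ∸ k ℕ.* B          ≡⟨ ≡.cong (suc k ℕ.* B ∸_) k*B≡[k+1]*D ⟩
      suc k ℕ.* B ∸ suc k ℕ.* D      ≡⟨ ℕ.*-distribˡ-∸ (suc k) B D ⟨
      suc k ℕ.* q                    ∎

  -- The two middle entries of row 2k + 1 agree, so Pascal's rule doubles one of them, and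
  -- absorption evaluates it.
  [k+1]*central[k+1]≡2[2k+1]*central : ∀ k →
    suc k ℕ.* central (suc k) ≡ (2 ℕ.* suc (2 ℕ.* k)) ℕ.* central k
  [k+1]*central[k+1]≡2[2k+1]*central k = begin
    suc k ℕ.* ((2 ℕ.* suc k) C suc k)
      ≡⟨ ≡.cong (λ m → suc k ℕ.* (m C suc k)) (ℕ.*-suc 2 k) ⟩
    suc k ℕ.* (suc m C suc k)
      ≡⟨ ≡.cong (suc k ℕ.*_) (nCk+nC[k+1]≡[n+1]C[k+1] m k) ⟨
    suc k ℕ.* (m C k ℕ.+ m C suc k)
      ≡⟨ ≡.cong (λ z → suc k ℕ.* (z ℕ.+ m C suc k)) symmetric ⟩
    suc k ℕ.* (m C suc k ℕ.+ m C suc k)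
      ≡⟨ solve 2 (λ k x → k :* (x :+ x) := con 2 :* (k :* x)) ≡.refl (suc k) (m C suc k) ⟩
    2 ℕ.* (suc k ℕ.* (m C suc k))
      ≡⟨ ≡.cong (2 ℕ.*_) ([k+1]*[n+1]C[k+1]≡[n+1]*nCk (2 ℕ.* k) k) ⟩
    2 ℕ.* (m ℕ.* central k)
      ≡⟨ ℕ.*-assoc 2 m (central k) ⟨
    (2 ℕ.* m) ℕ.* central k ∎
    where
    open ≡.≡-Reasoning
    open +-*-Solver
    m = suc (2 ℕ.* k)
    m≡ : m ≡ suc k ℕ.+ k
    m≡ = solve 1 (λ k → con 1 :+ con 2 :* k := con 1 :+ k :+ k) ≡.refl k
    symmetric : m C k ≡ m C suc k
    symmetric = ≡.trans
      (nCk≡nC[n∸k] (≡.subst (k ≤_) (≡.sym m≡) (ℕ.m≤n+m k (suc k))))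
      (≡.cong (m C_) (≡.trans (≡.cong (_∸ k) m≡) (ℕ.m+n∸n≡m (suc k) k)))

  [k+2]*catalan[k+1]≡2[2k+1]*catalan : ∀ k →
    suc (suc k) ℕ.* catalan (suc k) ≡ (2 ℕ.* suc (2 ℕ.* k)) ℕ.* catalan k
  [k+2]*catalan[k+1]≡2[2k+1]*catalan k = ≡.trans ([k+1]*catalan≡central (suc k))
    (ℕ.*-cancelˡ-≡ _ _ (suc k) (begin
      suc k ℕ.* central (suc k)
        ≡⟨ [k+1]*central[k+1]≡2[2k+1]*central k ⟩
      c ℕ.* central k
        ≡⟨ ≡.cong (c ℕ.*_) ([k+1]*catalan≡central k) ⟨
      c ℕ.* (suc k ℕ.* catalan k)
        ≡⟨ solve 3 (λ c k x → c :* (k :* x) := k :* (c :* x)) ≡.refl c (suc k) (catalan k) ⟩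
      suc k ℕ.* (c ℕ.* catalan k) ∎))
    where
    open ≡.≡-Reasoning
    open +-*-Solver
    c = 2 ℕ.* suc (2 ℕ.* k)

  -- Both summands are multiples of `catalan k`, with factors 4k + 2 and 2. The identity later
  -- trades a convolution with Catalan numbers for convolutions with central binomial coefficients.
  central-suc : ∀ k → central (suc k) ℕ.+ 2 ℕ.* catalan k ≡ 4 ℕ.* central k
  central-suc k = begin
    central (suc k) ℕ.+ 2 ℕ.* catalan k
      ≡⟨ ≡.cong (ℕ._+ 2 ℕ.* catalan k) ([k+1]*catalan≡central (suc k)) ⟨
    suc (suc k) ℕ.* catalan (suc k) ℕ.+ 2 ℕ.* catalan k
      ≡⟨ ≡.cong (ℕ._+ 2 ℕ.* catalan k) ([k+2]*catalan[k+1]≡2[2k+1]*catalan k) ⟩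
    (2 ℕ.* suc (2 ℕ.* k)) ℕ.* catalan k ℕ.+ 2 ℕ.* catalan k
      ≡⟨ solve 2 (λ k c → (con 2 :* (con 1 :+ con 2 :* k)) :* c :+ con 2 :* c :=
           con 4 :* ((con 1 :+ k) :* c)) ≡.refl k (catalan k) ⟩
    4 ℕ.* (suc k ℕ.* catalan k)
      ≡⟨ ≡.cong (4 ℕ.*_) ([k+1]*catalan≡central k) ⟩
    4 ℕ.* central k ∎
    where
    open ≡.≡-Reasoning
    open +-*-Solver

  open ℕ-Antidiagonal using (_⋆_; antidiag-cong; antidiag-+; antidiag-*ˡ; antidiag-last; ⋆-comm; ⋆-cong)

  -- Adding the reversed convolution replaces the weight i by i + j = k.
  ⋆-weight : ∀ f k → 2 ℕ.* ((λ i → i ℕ.* f i) ⋆ f) k ≡ k ℕ.* (f ⋆ f) k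
  ⋆-weight f k = begin
    2 ℕ.* (D ⋆ f) k
      ≡⟨ ≡.cong ((D ⋆ f) k ℕ.+_) (ℕ.+-identityʳ _) ⟩
    (D ⋆ f) k ℕ.+ (D ⋆ f) k
      ≡⟨ ≡.cong ((D ⋆ f) k ℕ.+_) (⋆-comm D f k) ⟩
    (D ⋆ f) k ℕ.+ (f ⋆ D) k
      ≡⟨ antidiag-+ _ _ k ⟨
    ℕ-Antidiagonal.antidiag (λ i j → D i ℕ.* f j ℕ.+ f i ℕ.* D j) k
      ≡⟨ antidiag-cong k (λ { i j ≡.refl →
           solve 4 (λ i j x y → i :* x :* y :+ x :* (j :* y) := (i :+ j) :* (x :* y)) ≡.refl i j (f i) (f j) }) ⟩
    ℕ-Antidiagonal.antidiag (λ i j → k ℕ.* (f i ℕ.* f j)) k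
      ≡⟨ antidiag-*ˡ k _ k ⟩
    k ℕ.* (f ⋆ f) k ∎
    where
    open ≡.≡-Reasoning
    open +-*-Solver
    D = λ i → i ℕ.* f i

  -- Write `central i` as `catalan i` plus i times it, and symmetrise the weighted part.
  central⋆catalan : ∀ k → 2 ℕ.* (central ⋆ catalan) k ≡ (2 ℕ.+ k) ℕ.* (catalan ⋆ catalan) k
  central⋆catalan k = begin
    2 ℕ.* (central ⋆ catalan) k
      ≡⟨ ≡.cong (2 ℕ.*_) (antidiag-cong k λ i j _ → ≡.trans
           (≡.cong (ℕ._* catalan j) (≡.sym ([k+1]*catalan≡central i)))
           (ℕ.*-distribʳ-+ (catalan j) (catalan i) (i ℕ.* catalan i))) ⟩
    2 ℕ.* ℕ-Antidiagonal.antidiag (λ i j → catalan i ℕ.* catalan j ℕ.+ i ℕ.* catalan i ℕ.* catalan j) k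
      ≡⟨ ≡.cong (2 ℕ.*_) (antidiag-+ _ _ k) ⟩
    2 ℕ.* ((catalan ⋆ catalan) k ℕ.+ ((λ i → i ℕ.* catalan i) ⋆ catalan) k)
      ≡⟨ ℕ.*-distribˡ-+ 2 ((catalan ⋆ catalan) k) _ ⟩
    2 ℕ.* (catalan ⋆ catalan) k ℕ.+ 2 ℕ.* ((λ i → i ℕ.* catalan i) ⋆ catalan) k
      ≡⟨ ≡.cong (2 ℕ.* (catalan ⋆ catalan) k ℕ.+_) (⋆-weight catalan k) ⟩
    2 ℕ.* (catalan ⋆ catalan) k ℕ.+ k ℕ.* (catalan ⋆ catalan) k
      ≡⟨ ℕ.*-distribʳ-+ ((catalan ⋆ catalan) k) 2 k ⟨
    (2 ℕ.+ k) ℕ.* (catalan ⋆ catalan) k ∎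
    where open ≡.≡-Reasoning

  -- With S k = Σ cᵢ c_{k-i}, symmetrising the weighted sum Σ (i + 1) cᵢ c_{k-i}
  -- gives (k + 2) S k / 2; comparing its values at k + 1 and k through
  -- (i + 2) cᵢ₊₁ = (4 i + 2) cᵢ yields (k + 3) S (k + 1) = (4 k + 6) c_{k+1}.
  catalan-suc : ∀ k → catalan (suc k) ≡ (catalan ⋆ catalan) k
  catalan-suc zero    = ≡.refl
  catalan-suc (suc k) = ℕ.*-cancelˡ-≡ _ _ (3 ℕ.+ k) (begin
    (3 ℕ.+ k) ℕ.* catalan (2 ℕ.+ k)
      ≡⟨ [k+2]*catalan[k+1]≡2[2k+1]*catalan (suc k) ⟩
    (2 ℕ.* suc (2 ℕ.* suc k)) ℕ.* c
      ≡⟨ solve 2 (λ k c → (con 2 :* (con 1 :+ con 2 :* (con 1 :+ k))) :* c :=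
           con 2 :* (con 1 :* c) :+ (con 2 :* (con 2 :* (k :* c) :+ con 2 :* c))) ≡.refl k c ⟩
    2 ℕ.* (1 ℕ.* c) ℕ.+ 2 ℕ.* (2 ℕ.* (k ℕ.* c) ℕ.+ 2 ℕ.* c)
      ≡⟨ ≡.cong (λ z → 2 ℕ.* (1 ℕ.* c) ℕ.+ 2 ℕ.* (2 ℕ.* (k ℕ.* z) ℕ.+ 2 ℕ.* z)) (catalan-suc k) ⟩
    2 ℕ.* (1 ℕ.* c) ℕ.+ 2 ℕ.* (2 ℕ.* (k ℕ.* S) ℕ.+ 2 ℕ.* S)
      ≡⟨ ≡.cong (λ z → 2 ℕ.* (1 ℕ.* c) ℕ.+ 2 ℕ.* (2 ℕ.* z ℕ.+ 2 ℕ.* S)) (⋆-weight catalan k) ⟨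
    2 ℕ.* (1 ℕ.* c) ℕ.+ 2 ℕ.* (2 ℕ.* (2 ℕ.* W) ℕ.+ 2 ℕ.* S)
      ≡⟨ ≡.cong (λ z → 2 ℕ.* (1 ℕ.* c) ℕ.+ 2 ℕ.* z) shifted ⟨
    2 ℕ.* (1 ℕ.* c) ℕ.+ 2 ℕ.* ((λ i → central (suc i)) ⋆ catalan) k
      ≡⟨ ℕ.*-distribˡ-+ 2 (1 ℕ.* c) _ ⟨
    2 ℕ.* (central ⋆ catalan) (suc k)
      ≡⟨ central⋆catalan (suc k) ⟩
    (3 ℕ.+ k) ℕ.* (catalan ⋆ catalan) (suc k) ∎)
    where
    open ≡.≡-Reasoning
    open +-*-Solver
    c = catalan (suc k)
    S = (catalan ⋆ catalan) k
    W = ((λ i → i ℕ.* catalan i) ⋆ catalan) k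
    shifted : ((λ i → central (suc i)) ⋆ catalan) k ≡ 2 ℕ.* (2 ℕ.* W) ℕ.+ 2 ℕ.* S
    shifted = begin
      ((λ i → central (suc i)) ⋆ catalan) k
        ≡⟨ antidiag-cong k (λ i j _ → ≡.trans
             (≡.cong (ℕ._* catalan j) (≡.trans (≡.sym ([k+1]*catalan≡central (suc i)))
               ([k+2]*catalan[k+1]≡2[2k+1]*catalan i)))
             (solve 3 (λ i x y → (con 2 :* (con 1 :+ con 2 :* i)) :* x :* y :=
               con 4 :* (i :* x :* y) :+ con 2 :* (x :* y)) ≡.refl i (catalan i) (catalan j))) ⟩
      ℕ-Antidiagonal.antidiag (λ i j → 4 ℕ.* (i ℕ.* catalan i ℕ.* catalan j) ℕ.+ 2 ℕ.* (catalan i ℕ.* catalan j)) k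
        ≡⟨ antidiag-+ _ _ k ⟩
      _ ≡⟨ ≡.cong₂ ℕ._+_ (antidiag-*ˡ 4 _ k) (antidiag-*ˡ 2 _ k) ⟩
      4 ℕ.* W ℕ.+ 2 ℕ.* S
        ≡⟨ solve 2 (λ w s → con 4 :* w :+ con 2 :* s := con 2 :* (con 2 :* w) :+ con 2 :* s) ≡.refl W S ⟩
      2 ℕ.* (2 ℕ.* W) ℕ.+ 2 ℕ.* S ∎

  -- On generating functions this is b = 1 + 2 x c b. The factor k + 2 between `catalan (suc k)` and
  -- `central (suc k)` is the one that symmetrisation produces.
  central-suc-⋆ : ∀ k → central (suc k) ≡ 2 ℕ.* (catalan ⋆ central) k
  central-suc-⋆ k = begin
    central (suc k)                        ≡⟨ [k+1]*catalan≡central (suc k) ⟨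
    (2 ℕ.+ k) ℕ.* catalan (suc k)          ≡⟨ ≡.cong ((2 ℕ.+ k) ℕ.*_) (catalan-suc k) ⟩
    (2 ℕ.+ k) ℕ.* (catalan ⋆ catalan) k    ≡⟨ central⋆catalan k ⟨
    2 ℕ.* (central ⋆ catalan) k            ≡⟨ ≡.cong (2 ℕ.*_) (⋆-comm central catalan k) ⟩
    2 ℕ.* (catalan ⋆ central) k            ∎
    where open ≡.≡-Reasoning

open CatalanNumbers

-- Generating functions of the weights and the closed form.

module Weights {a ℓ} (R : CommutativeRing a ℓ) (w half : CommutativeRing.Carrier R)
  (half+half≈1 : CommutativeRing._≈_ R (CommutativeRing._+_ R half half) (CommutativeRing.1# R))
  where

  open CommutativeRing R
  open SetoidReasoning setoid
  open Antidiagonal commutativeSemiring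
  open ℕ-Antidiagonal using () renaming (antidiag to antidiagℕ; _⋆_ to _⋆ℕ_)
  open Exp semiring using (_^_)
  open Mult semiring using (×-homo-+; ×1-homo-*) renaming (_×_ to _·_)
  open NatSolver commutativeSemiring using (solve; con; _:+_; _:*_; _:=_)
  open GroupProperties +-group using (∙-cancelʳ)

  ι : ℕ → Carrier
  ι k = k · 1#

  ι-+ : ∀ m n → ι (m ℕ.+ n) ≈ ι m + ι n
  ι-+ = ×-homo-+ 1#

  ι-* : ∀ m n → ι (m ℕ.* n) ≈ ι m * ι n
  ι-* = ×1-homo-*

  ι-⋆ : ∀ f g k → ι ((f ⋆ℕ g) k) ≈ ((λ i → ι (f i)) ⋆ (λ i → ι (g i))) k
  ι-⋆ f g k = trans (ι-antidiag (λ i j → f i ℕ.* g j) k) (antidiag-cong k λ i j _ → ι-* (f i) (g j))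
    where
    ι-antidiag : ∀ φ k → ι (antidiagℕ φ k) ≈ antidiag (λ i j → ι (φ i j)) k
    ι-antidiag φ zero    = refl
    ι-antidiag φ (suc k) = trans (ι-+ (φ 0 (suc k)) _) (+-congˡ (ι-antidiag (λ i j → φ (suc i) j) k))

  -- The generating function of `v` is c (w x), and `δ` is the unit of the convolution.
  c b v δ : ℕ → Carrier
  c k = ι (catalan k)
  b k = ι (central k)
  v k = w ^ k * c k
  δ zero    = 1#
  δ (suc k) = 0#

  two : Carrier
  two = ι 2

  c₀≈1 : c 0 ≈ 1#
  c₀≈1 = refl

  b₀≈1 : b 0 ≈ 1#
  b₀≈1 = refl

  two*x≈x+x : ∀ x → two * x ≈ x + x
  two*x≈x+x = solve 1 (λ x → con 2 :* x := x :+ x) refl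

  b-suc : ∀ k → b (suc k) ≈ two * (c ⋆ b) k
  b-suc k = trans (reflexive (≡.cong ι (central-suc-⋆ k)))
    (trans (ι-* 2 ((catalan ⋆ℕ central) k)) (*-congˡ (ι-⋆ catalan central k)))

  -- Doubled, this combines `central-suc-⋆` with `central-suc`; the factor 2 is cancelled among the
  -- natural numbers before the cast.
  c⋆b : ∀ k → (c ⋆ b) k + c k ≈ two * b k
  c⋆b k = begin
    (c ⋆ b) k + c k             ≈⟨ +-congʳ (ι-⋆ catalan central k) ⟨
    ι ((catalan ⋆ℕ central) k) + c k      ≈⟨ ι-+ ((catalan ⋆ℕ central) k) (catalan k) ⟨
    ι ((catalan ⋆ℕ central) k ℕ.+ catalan k) ≈⟨ reflexive (≡.cong ι eq) ⟩
    ι (2 ℕ.* central k)         ≈⟨ ι-* 2 (central k) ⟩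
    two * b k                   ∎
    where
    eq : (catalan ⋆ℕ central) k ℕ.+ catalan k ≡ 2 ℕ.* central k
    eq = ℕ.*-cancelˡ-≡ ((catalan ⋆ℕ central) k ℕ.+ catalan k) _ 2 (≡.trans (ℕ.*-distribˡ-+ 2 ((catalan ⋆ℕ central) k) (catalan k))
      (≡.trans (≡.cong (ℕ._+ 2 ℕ.* catalan k) (≡.sym (central-suc-⋆ k)))
        (≡.trans (central-suc k) (ℕ.*-assoc 2 2 (central k)))))

  antidiag-0 : ∀ {φ} k → (∀ i j → φ i j ≈ 0#) → antidiag φ k ≈ 0#
  antidiag-0 zero    φ≈0 = φ≈0 0 0
  antidiag-0 (suc k) φ≈0 = trans (+-cong (φ≈0 0 (suc k)) (antidiag-0 k λ i j → φ≈0 (suc i) j)) (+-identityˡ 0#)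

  antidiag-ends : ∀ φ k → (∀ i j → φ (suc i) (suc j) ≈ 0#) →
                  antidiag φ (suc k) ≈ φ 0 (suc k) + φ (suc k) 0
  antidiag-ends φ zero    φ≈0 = refl
  antidiag-ends φ (suc k) φ≈0 = +-congˡ (trans (antidiag-last (λ i j → φ (suc i) j) k)
    (trans (+-congˡ (antidiag-0 k φ≈0)) (+-identityʳ _)))

  δ⋆ : ∀ f k → (δ ⋆ f) k ≈ f k
  δ⋆ f zero    = *-identityˡ _
  δ⋆ f (suc k) = trans (+-cong (*-identityˡ _) (antidiag-0 k λ _ _ → zeroˡ _)) (+-identityʳ _)

  -- Weights of the triangle cutting off polygons with i and j triangles,
  -- when exactly one of its other two sides, respectively its third side,
  -- is on the perimeter.
  mean inner outer : ℕ → ℕ → Carrier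
  mean i j = (w ^ suc i + w ^ suc j) * half

  inner zero    zero    = 0#
  inner zero    (suc j) = mean 0 (suc j)
  inner (suc i) zero    = mean (suc i) 0
  inner (suc i) (suc j) = 0#

  outer zero    j       = 0#
  outer (suc i) zero    = 0#
  outer (suc i) (suc j) = mean (suc i) (suc j)

  F : ℕ → Carrier
  F = antidiag (λ i j → inner i j * (c i * c j))

  mean*c*c : ∀ i j → mean i j * (c i * c j) ≈ half * (w * (v i * c j) + w * (c i * v j))
  mean*c*c i j = solve 6 (λ w wⁱ wʲ h x y →
    (w :* wⁱ :+ w :* wʲ) :* h :* (x :* y) :=
    h :* (w :* (wⁱ :* x :* y) :+ w :* (x :* (wʲ :* y)))) refl w (w ^ i) (w ^ j) half (c i) (c j)

  half*x+x : ∀ x → half * (x + x) ≈ x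
  half*x+x x = trans (solve 2 (λ h x → h :* (x :+ x) := (h :+ h) :* x) refl half x)
    (trans (*-congʳ half+half≈1) (*-identityˡ x))

  -- `inner` needs exactly one empty piece, so only the two ends of the convolution survive. They
  -- are mirror images, and their sum absorbs the half.
  F-suc : ∀ k → F (suc k) ≈ w * (c (suc k) + v (suc k))
  F-suc k = begin
    F (suc k)
      ≈⟨ antidiag-ends (λ i j → inner i j * (c i * c j)) k (λ _ _ → zeroˡ _) ⟩
    mean 0 (suc k) * (c 0 * c (suc k)) + mean (suc k) 0 * (c (suc k) * c 0)
      ≈⟨ +-cong (*-congˡ (trans (*-congʳ c₀≈1) (*-identityˡ _)))
                (*-congˡ (trans (*-congˡ c₀≈1) (*-identityʳ _))) ⟩
    mean 0 (suc k) * c (suc k) + mean (suc k) 0 * c (suc k)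
      ≈⟨ solve 4 (λ w wᵏ h x →
           (w :* con 1 :+ w :* wᵏ) :* h :* x :+ (w :* wᵏ :+ w :* con 1) :* h :* x :=
           h :* (w :* (x :+ wᵏ :* x) :+ w :* (x :+ wᵏ :* x))) refl w (w ^ suc k) half (c (suc k)) ⟩
    half * (w * (c (suc k) + v (suc k)) + w * (c (suc k) + v (suc k)))
      ≈⟨ half*x+x _ ⟩
    w * (c (suc k) + v (suc k)) ∎

  -- At index 0 both pieces are empty and `F` vanishes, whereas the formula of `F-suc` would give 2
  -- w. The `δ` term repairs this, so that the identity can be convolved with `b`.
  F+2wδ : ∀ k → F k + two * w * δ k ≈ w * (c k + v k)
  F+2wδ zero    = begin
    0# * (c 0 * c 0) + two * w * 1#  ≈⟨ solve 2 (λ w x → con 0 :* (x :* x) :+ con 2 :* w :* con 1 := w :* (con 1 :+ con 1 :* con 1)) refl w (c 0) ⟩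
    w * (1# + 1# * 1#)               ≈⟨ *-congˡ (+-cong c₀≈1 (*-congˡ c₀≈1)) ⟨
    w * (c 0 + v 0)                  ∎
  F+2wδ (suc k) = trans (trans (+-congˡ (zeroʳ _)) (+-identityʳ _)) (F-suc k)

  -- Convolving `F+2wδ` with b gives F b + 2 w b = w (c b + v b), and c b + c = 2 b removes c b.
  -- Adding 2 w b on both sides avoids subtraction.
  F⋆b : ∀ k → (F ⋆ b) k + w * c k ≈ w * (v ⋆ b) k
  F⋆b k = ∙-cancelʳ (two * w * b k) _ _ (begin
    (F ⋆ b) k + w * c k + two * w * b k
      ≈⟨ +-congˡ (*-congˡ (δ⋆ b k)) ⟨
    (F ⋆ b) k + w * c k + two * w * (δ ⋆ b) k
      ≈⟨ solve 3 (λ x y z → x :+ y :+ z := x :+ z :+ y) refl _ _ _ ⟩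
    (F ⋆ b) k + two * w * (δ ⋆ b) k + w * c k
      ≈⟨ +-congʳ F⋆b+δ⋆b ⟩
    w * ((c ⋆ b) k + (v ⋆ b) k) + w * c k
      ≈⟨ solve 4 (λ w x y z → w :* (x :+ y) :+ w :* z := w :* y :+ w :* (x :+ z)) refl w _ _ _ ⟩
    w * (v ⋆ b) k + w * ((c ⋆ b) k + c k)
      ≈⟨ +-congˡ (*-congˡ (c⋆b k)) ⟩
    w * (v ⋆ b) k + w * (two * b k)
      ≈⟨ +-congˡ (solve 2 (λ w x → w :* (con 2 :* x) := con 2 :* w :* x) refl w (b k)) ⟩
    w * (v ⋆ b) k + two * w * b k ∎)
    where
    F⋆b+δ⋆b : (F ⋆ b) k + two * w * (δ ⋆ b) k ≈ w * ((c ⋆ b) k + (v ⋆ b) k)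
    F⋆b+δ⋆b = begin
      (F ⋆ b) k + two * w * (δ ⋆ b) k
        ≈⟨ +-congˡ (antidiag-*ˡ (two * w) _ k) ⟨
      (F ⋆ b) k + antidiag (λ i j → two * w * (δ i * b j)) k
        ≈⟨ antidiag-+ _ _ k ⟨
      antidiag (λ i j → F i * b j + two * w * (δ i * b j)) k
        ≈⟨ antidiag-cong k (λ i j _ → begin
             F i * b j + two * w * (δ i * b j)
               ≈⟨ solve 4 (λ x y z d → x :* y :+ z :* (d :* y) := (x :+ z :* d) :* y) refl (F i) (b j) (two * w) (δ i) ⟩
             (F i + two * w * δ i) * b j
               ≈⟨ *-congʳ (F+2wδ i) ⟩
             w * (c i + v i) * b j
               ≈⟨ solve 4 (λ w x y z → w :* (x :+ y) :* z := w :* (x :* z :+ y :* z)) refl w (c i) (v i) (b j) ⟩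
             w * (c i * b j + v i * b j) ∎) ⟩
      antidiag (λ i j → w * (c i * b j + v i * b j)) k
        ≈⟨ antidiag-*ˡ w _ k ⟩
      w * antidiag (λ i j → c i * b j + v i * b j) k
        ≈⟨ *-congˡ (antidiag-+ _ _ k) ⟩
      w * ((c ⋆ b) k + (v ⋆ b) k) ∎

  -- On generating functions c = 1 + x c² and b = 1 + 2 x c b, so s = x F b is the
  -- solution of s = x (F + 2 c s), which decomposes by the triangle on the base.
  s : ℕ → Carrier
  s zero    = 0#
  s (suc k) = (F ⋆ b) k

  s-suc : ∀ k → s (suc k) ≈ F k + two * (c ⋆ s) k
  s-suc zero    = begin
    F 0 * b 0             ≈⟨ *-congˡ b₀≈1 ⟩
    F 0 * 1#              ≈⟨ solve 2 (λ x y → x :* con 1 := x :+ con 2 :* (y :* con 0)) refl (F 0) (c 0) ⟩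
    F 0 + two * (c 0 * 0#) ∎
  s-suc (suc k) = begin
    (F ⋆ b) (suc k)
      ≈⟨ antidiag-last (λ i j → F i * b j) k ⟩
    F (suc k) * b 0 + (F ⋆ (λ i → b (suc i))) k
      ≈⟨ +-cong (trans (*-congˡ b₀≈1) (*-identityʳ _)) (⋆-cong k (λ _ _ → refl) (λ i _ → b-suc i)) ⟩
    F (suc k) + (F ⋆ (λ i → two * (c ⋆ b) i)) k
      ≈⟨ +-congˡ (⋆-scaleʳ two F (c ⋆ b) k) ⟩
    F (suc k) + two * (F ⋆ (c ⋆ b)) k
      ≈⟨ +-congˡ (*-congˡ (trans (sym (⋆-assoc F c b k))
           (trans (⋆-cong k (λ i _ → ⋆-comm F c i) (λ _ _ → refl)) (⋆-assoc c F b k)))) ⟩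
    F (suc k) + two * (c ⋆ (F ⋆ b)) k
      -- Since `s 0` vanishes, the convolution with `s` is the one with `F ⋆ b`, one index lower.
      ≈⟨ +-congˡ (*-congˡ (trans (antidiag-last (λ i j → c i * s j) k) (trans (+-congʳ (zeroʳ _)) (+-identityˡ _)))) ⟨
    F (suc k) + two * (c ⋆ s) (suc k) ∎

  -- Total over the trees with k + 1 nodes when the base triangle weighs `φ i j`: that weight occurs
  -- once per pair of subtrees, and the total of either subtree once per choice of the other.
  baseSum : (ℕ → ℕ → Carrier) → ℕ → Carrier
  baseSum φ = antidiag (λ i j → φ i j * (c i * c j) + (s i * c j + c i * s j))

  baseSum≈ : ∀ φ k → baseSum φ k ≈ antidiag (λ i j → φ i j * (c i * c j)) k + two * (c ⋆ s) k
  baseSum≈ φ k = begin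
    baseSum φ k
      ≈⟨ antidiag-+ _ _ k ⟩
    _ + antidiag (λ i j → s i * c j + c i * s j) k
      ≈⟨ +-congˡ (antidiag-+ _ _ k) ⟩
    _ + ((s ⋆ c) k + (c ⋆ s) k)
      ≈⟨ +-congˡ (+-congʳ (⋆-comm s c k)) ⟩
    _ + ((c ⋆ s) k + (c ⋆ s) k)
      ≈⟨ +-congˡ (two*x≈x+x _) ⟨
    _ + two * (c ⋆ s) k ∎

  s-suc-baseSum : ∀ k → s (suc k) ≈ baseSum inner k
  s-suc-baseSum k = trans (s-suc k) (sym (baseSum≈ inner k))

  -- The two weights add up to `mean` unless both pieces are empty, which a positive index rules
  -- out. Commutativity of the convolution then absorbs the half.
  outer+inner : ∀ m → antidiag (λ i j → outer i j * (c i * c j)) (suc m) + F (suc m) ≈ w * (v ⋆ c) (suc m)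
  outer+inner m = begin
    antidiag (λ i j → outer i j * (c i * c j)) k + F k
      ≈⟨ antidiag-+ (λ i j → outer i j * (c i * c j)) (λ i j → inner i j * (c i * c j)) k ⟨
    antidiag (λ i j → outer i j * (c i * c j) + inner i j * (c i * c j)) k
      ≈⟨ antidiag-cong k (λ i j i+j≡k → trans (sym (distribʳ _ _ _))
           (trans (*-congʳ (split i j i+j≡k)) (mean*c*c i j))) ⟩
    antidiag (λ i j → half * (w * (v i * c j) + w * (c i * v j))) k
      ≈⟨ antidiag-*ˡ half (λ i j → w * (v i * c j) + w * (c i * v j)) k ⟩
    half * antidiag (λ i j → w * (v i * c j) + w * (c i * v j)) k
      ≈⟨ *-congˡ (trans (antidiag-+ (λ i j → w * (v i * c j)) (λ i j → w * (c i * v j)) k)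
           (+-cong (antidiag-*ˡ w (λ i j → v i * c j) k) (antidiag-*ˡ w (λ i j → c i * v j) k))) ⟩
    half * (w * (v ⋆ c) k + w * (c ⋆ v) k)
      ≈⟨ *-congˡ (+-congˡ (*-congˡ (⋆-comm c v k))) ⟩
    half * (w * (v ⋆ c) k + w * (v ⋆ c) k)
      ≈⟨ half*x+x _ ⟩
    w * (v ⋆ c) k ∎
    where
    k = suc m
    split : ∀ i j → i ℕ.+ j ≡ k → outer i j + inner i j ≈ mean i j
    split zero    (suc j) _ = +-identityˡ _
    split (suc i) zero    _ = +-identityˡ _
    split (suc i) (suc j) _ = +-identityʳ _

  -- `F` is missing once from the base triangles and once from 2 c s, and `F⋆b` lacks a further w c;
  -- the correction on the left is 2 F + w c.
  total : ∀ m → let k = suc m in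
    baseSum outer k + c k * (ι 2 * w ^ suc k + ι 3 * w) ≈ w * ((v ⋆ c) k + (v ⋆ b) k)
  total m = begin
    baseSum outer k + c k * (ι 2 * w ^ suc k + ι 3 * w)
      ≈⟨ +-congʳ (baseSum≈ outer k) ⟩
    G + T + c k * (ι 2 * (w * w ^ k) + ι 3 * w)
      ≈⟨ solve 5 (λ g t w wᵏ x → g :+ t :+ x :* (con 2 :* (w :* wᵏ) :+ con 3 :* w) :=
           g :+ w :* (x :+ wᵏ :* x) :+ (w :* (x :+ wᵏ :* x) :+ t :+ w :* x)) refl G T w (w ^ k) (c k) ⟩
    G + w * (c k + v k) + (w * (c k + v k) + T + w * c k)
      ≈⟨ +-cong (+-congˡ (F-suc m)) (+-congʳ (+-congʳ (F-suc m))) ⟨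
    G + F k + (F k + T + w * c k)
      ≈⟨ +-cong (outer+inner m) (trans (+-congʳ (sym (s-suc k))) (F⋆b k)) ⟩
    w * (v ⋆ c) k + w * (v ⋆ b) k
      ≈⟨ distribˡ _ _ _ ⟨
    w * ((v ⋆ c) k + (v ⋆ b) k) ∎
    where
    k = suc m
    G = antidiag (λ i j → outer i j * (c i * c j)) k
    T = two * (c ⋆ s) k

  -- With k = n - 3, the elements `L`, `L₂` and `e` play the reciprocals of C_(n-2), 2 C_(n-2) and 2
  -- (2n - 5).
  closedForm : ∀ m → let k = suc m in ∀ L L₂ e →
    c (suc k) * L ≈ 1# → ι (2 ℕ.* catalan (suc k)) * L₂ ≈ 1# → ι (2 ℕ.* suc (2 ℕ.* k)) * e ≈ 1# →
    baseSum outer k * L ≈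
      - (ι (2 ℕ.+ k) * (ι 2 * w ^ suc k + ι 3 * w) * e) + ι 3 * w * L * (v ⋆ b) k
      - w * L₂ * (v ⋆ (λ i → b (suc i))) k
  closedForm m L L₂ e cL≈1 2cL₂≈1 qe≈1 = begin
    T                                ≈⟨ x+y-y≈x T Z ⟨
    T + Z - Z                        ≈⟨ +-congʳ (trans (sym (+-assoc (- X) X _)) (trans (+-congʳ (-‿inverseˡ X)) (+-identityˡ _))) ⟨
    - X + (X + (T + Z)) - Z          ≈⟨ +-congʳ (+-congˡ T+X+Z≈Y) ⟩
    - X + Y - Z                      ∎
    where
    k = suc m
    P = ι 2 * w ^ suc k + ι 3 * w
    T = baseSum outer k * L
    X = ι (2 ℕ.+ k) * P * e
    Y = ι 3 * w * L * (v ⋆ b) k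
    Z = w * L₂ * (v ⋆ (λ i → b (suc i))) k

    x+y-y≈x : ∀ x y → x + y - y ≈ x
    x+y-y≈x x y = trans (+-assoc x y (- y)) (trans (+-congˡ (-‿inverseʳ y)) (+-identityʳ x))

    -- The ratio of consecutive Catalan numbers, expressed through the two reciprocals.
    [k+2]*e≈c*L : ι (2 ℕ.+ k) * e ≈ c k * L
    [k+2]*e≈c*L = begin
      ι (2 ℕ.+ k) * e                          ≈⟨ *-identityʳ _ ⟨
      ι (2 ℕ.+ k) * e * 1#                     ≈⟨ *-congˡ cL≈1 ⟨
      ι (2 ℕ.+ k) * e * (c (suc k) * L)        ≈⟨ solve 4 (λ x y z t → x :* y :* (z :* t) := x :* z :* (y :* t)) refl _ e _ L ⟩
      ι (2 ℕ.+ k) * c (suc k) * (e * L)        ≈⟨ *-congʳ (trans (sym (ι-* (2 ℕ.+ k) (catalan (suc k))))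
        (trans (reflexive (≡.cong ι ([k+2]*catalan[k+1]≡2[2k+1]*catalan k))) (ι-* (2 ℕ.* suc (2 ℕ.* k)) (catalan k)))) ⟩
      ι (2 ℕ.* suc (2 ℕ.* k)) * c k * (e * L)  ≈⟨ solve 4 (λ x y z t → x :* z :* (y :* t) := x :* y :* (z :* t)) refl _ e (c k) L ⟩
      ι (2 ℕ.* suc (2 ℕ.* k)) * e * (c k * L)  ≈⟨ trans (*-congʳ qe≈1) (*-identityˡ _) ⟩
      c k * L                                  ∎

    two*L₂≈L : two * L₂ ≈ L
    two*L₂≈L = begin
      two * L₂                         ≈⟨ *-identityʳ _ ⟨
      two * L₂ * 1#                    ≈⟨ *-congˡ cL≈1 ⟨
      two * L₂ * (c (suc k) * L)       ≈⟨ solve 4 (λ x y z t → x :* y :* (z :* t) := x :* z :* y :* t) refl two L₂ _ L ⟩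
      two * c (suc k) * L₂ * L         ≈⟨ *-congʳ (trans (*-congʳ (sym (ι-* 2 (catalan (suc k))))) 2cL₂≈1) ⟩
      1# * L                           ≈⟨ *-identityˡ L ⟩
      L                                ∎

    b-suc+2c≈4b : ∀ i → b (suc i) + two * c i ≈ ι 4 * b i
    b-suc+2c≈4b i = begin
      b (suc i) + two * c i                       ≈⟨ +-congˡ (ι-* 2 (catalan i)) ⟨
      b (suc i) + ι (2 ℕ.* catalan i)             ≈⟨ ι-+ (central (suc i)) (2 ℕ.* catalan i) ⟨
      ι (central (suc i) ℕ.+ 2 ℕ.* catalan i)     ≈⟨ reflexive (≡.cong ι (central-suc i)) ⟩
      ι (4 ℕ.* central i)                         ≈⟨ ι-* 4 (central i) ⟩
      ι 4 * b i                                   ∎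

    v⋆b-suc : (v ⋆ (λ i → b (suc i))) k + two * (v ⋆ c) k ≈ ι 4 * (v ⋆ b) k
    v⋆b-suc = begin
      (v ⋆ (λ i → b (suc i))) k + two * (v ⋆ c) k              ≈⟨ +-congˡ (⋆-scaleʳ two v c k) ⟨
      (v ⋆ (λ i → b (suc i))) k + (v ⋆ (λ i → two * c i)) k    ≈⟨ ⋆-distribˡ v (λ i → b (suc i)) (λ i → two * c i) k ⟨
      (v ⋆ (λ i → b (suc i) + two * c i)) k                    ≈⟨ ⋆-cong {v} k (λ _ _ → refl) (λ i _ → b-suc+2c≈4b i) ⟩
      (v ⋆ (λ i → ι 4 * b i)) k                                ≈⟨ ⋆-scaleʳ (ι 4) v b k ⟩
      ι 4 * (v ⋆ b) k                                          ∎

    X≈ : X ≈ c k * P * L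
    X≈ = begin
      ι (2 ℕ.+ k) * P * e    ≈⟨ solve 3 (λ x p e → x :* p :* e := x :* e :* p) refl (ι (2 ℕ.+ k)) P e ⟩
      ι (2 ℕ.+ k) * e * P    ≈⟨ *-congʳ [k+2]*e≈c*L ⟩
      c k * L * P            ≈⟨ solve 3 (λ x l p → x :* l :* p := x :* p :* l) refl (c k) L P ⟩
      c k * P * L            ∎

    -- Hence w L (v c + v b) is 3 w L (v b) minus `Z`, which explains the coefficients of the two
    -- sums.
    Z+wLvc : Z + w * L * (v ⋆ c) k ≈ two * (w * L * (v ⋆ b) k)
    Z+wLvc = begin
      w * L₂ * V + w * L * C          ≈⟨ +-congˡ (*-congʳ (*-congˡ two*L₂≈L)) ⟨
      w * L₂ * V + w * (two * L₂) * C ≈⟨ solve 4 (λ w l x y → w :* l :* x :+ w :* (con 2 :* l) :* y := w :* l :* (x :+ con 2 :* y)) refl w L₂ V C ⟩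
      w * L₂ * (V + two * C)          ≈⟨ *-congˡ v⋆b-suc ⟩
      w * L₂ * (ι 4 * B)              ≈⟨ solve 3 (λ w l x → w :* l :* (con 4 :* x) := con 2 :* (w :* (con 2 :* l) :* x)) refl w L₂ B ⟩
      two * (w * (two * L₂) * B)      ≈⟨ *-congˡ (*-congʳ (*-congˡ two*L₂≈L)) ⟩
      two * (w * L * B)               ∎
      where
      V = (v ⋆ (λ i → b (suc i))) k
      C = (v ⋆ c) k
      B = (v ⋆ b) k

    T+X+Z≈Y : X + (T + Z) ≈ Y
    T+X+Z≈Y = ∙-cancelʳ (w * L * (v ⋆ c) k) _ _ (begin
      X + (T + Z) + w * L * (v ⋆ c) k
        ≈⟨ +-congʳ (+-congʳ X≈) ⟩
      c k * P * L + (T + Z) + w * L * (v ⋆ c) k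
        ≈⟨ solve 5 (λ x g l z u → x :* l :+ (g :* l :+ z) :+ u := (g :+ x) :* l :+ (z :+ u)) refl
             (c k * P) (baseSum outer k) L Z (w * L * (v ⋆ c) k) ⟩
      (baseSum outer k + c k * P) * L + (Z + w * L * (v ⋆ c) k)
        ≈⟨ +-cong (*-congʳ (total m)) Z+wLvc ⟩
      w * ((v ⋆ c) k + (v ⋆ b) k) * L + two * (w * L * (v ⋆ b) k)
        ≈⟨ solve 4 (λ w l x y → w :* (x :+ y) :* l :+ con 2 :* (w :* l :* y) := con 3 :* w :* l :* y :+ w :* l :* x) refl w L ((v ⋆ c) k) ((v ⋆ b) k) ⟩
      Y + w * L * (v ⋆ c) k ∎)

-- Lists: permutations, sublists and unions over antidiagonals.

private
  variable
    ℓ₁ ℓ₂ ℓ₃ ℓ₄ : Level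
    A : Set ℓ₁
    B : Set ℓ₂
    D : Set ℓ₄

∈⇒↭∷ : ∀ {x : A} {xs} → x ∈ xs → ∃ λ ys → xs ↭ x ∷ ys
∈⇒↭∷ x∈xs with ∈-∃++ x∈xs
... | ys , zs , ≡.refl = ys ++ zs , shift _ ys zs

⊆-∷⁻ : ∀ {x : A} {xs ys zs} → Unique (x ∷ xs) → x ∷ xs ⊆ ys → ys ↭ x ∷ zs → xs ⊆ zs
⊆-∷⁻ (x∉ ∷ _) sub ys↭ y∈xs with ∈-resp-↭ ys↭ (sub (there y∈xs))
... | here ≡.refl = contradiction ≡.refl (All.lookup x∉ y∈xs)
... | there y∈zs  = y∈zs

-- The pigeonhole principle. Through it the number n - 3 forces a noncrossing set to exhaust the
-- chords of its tree.
unique-⊆-length⇒↭ : ∀ {xs ys : List A} → Unique xs → xs ⊆ ys → length ys ≤ length xs → xs ↭ ys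
unique-⊆-length⇒↭ {xs = []}     {[]} _ _ _ = ↭-refl
unique-⊆-length⇒↭ {xs = x ∷ xs} u@(_ ∷ uxs) sub ≤ with ∈⇒↭∷ (sub (here ≡.refl))
... | zs , ys↭ = ↭-trans
  (↭-prep x (unique-⊆-length⇒↭ uxs (⊆-∷⁻ u sub ys↭)
    (ℕ.s≤s⁻¹ (≡.subst (_≤ suc (length xs)) (↭-length ys↭) ≤))))
  (↭-sym ys↭)

unique-⊆-⊇⇒↭ : ∀ {xs ys : List A} → Unique xs → Unique ys → xs ⊆ ys → ys ⊆ xs → xs ↭ ys
unique-⊆-⊇⇒↭ uxs uys sub sup = unique-⊆-length⇒↭ uxs sub (unique-⊆⇒length≤ uys sup)
  where
  unique-⊆⇒length≤ : ∀ {xs ys : List _} → Unique xs → xs ⊆ ys → length xs ≤ length ys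
  unique-⊆⇒length≤ {xs = []} _ _ = z≤n
  unique-⊆⇒length≤ {xs = x ∷ xs} u@(_ ∷ uxs) sub with ∈⇒↭∷ (sub (here ≡.refl))
  ... | zs , ys↭ = ≡.subst (suc (length xs) ≤_) (≡.sym (↭-length ys↭))
    (s≤s (unique-⊆⇒length≤ uxs (⊆-∷⁻ u sub ys↭)))

-- Injectivity is asked only on the list, because `fromTree n` will be known to be injective only on
-- trees of the right size.
unique-map-on : ∀ {f : A → B} {xs} → (∀ {x y} → x ∈ xs → y ∈ xs → f x ≡ f y → x ≡ y) →
                Unique xs → Unique (map f xs)
unique-map-on inj []         = []
unique-map-on {f = f} inj (x∉ ∷ uxs) =
  All.tabulate (λ y∈ fx≡y → let z , z∈ , y≡fz = ∈-map⁻ f y∈ in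
    All.lookup x∉ z∈ (inj (here ≡.refl) (there z∈) (≡.trans fx≡y y≡fz)))
  ∷ unique-map-on (λ x∈ y∈ → inj (there x∈) (there y∈)) uxs

allPairs-tabulate : ∀ {R : Rel A ℓ₃} {xs} → (∀ {x y} → x ∈ xs → y ∈ xs → R x y) → AllPairs R xs
allPairs-tabulate {xs = []}     f = []
allPairs-tabulate {xs = x ∷ xs} f =
  All.tabulate (λ y∈ → f (here ≡.refl) (there y∈)) ∷ allPairs-tabulate (λ x∈ y∈ → f (there x∈) (there y∈))

∈-sublists⇒⊆ : ∀ {xs ys : List A} → xs ∈ sublists ys → xs ⊆ ys
∈-sublists⇒⊆ {ys = []}     (here ≡.refl) x∈ = x∈
∈-sublists⇒⊆ {ys = y ∷ ys} xs∈ x∈ with ∈-++⁻ (map (y ∷_) (sublists ys)) xs∈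
... | inj₂ xs∈ʳ = there (∈-sublists⇒⊆ xs∈ʳ x∈)
... | inj₁ xs∈ˡ with ∈-map⁻ (y ∷_) xs∈ˡ | x∈
...   | _ , _   , ≡.refl | here eq   = here eq
...   | _ , zs∈ , ≡.refl | there x∈′ = there (∈-sublists⇒⊆ zs∈ x∈′)

filter-∈-sublists : ∀ {P : Pred A ℓ₃} (P? : Decidable P) xs → filter P? xs ∈ sublists xs
filter-∈-sublists P? []       = here ≡.refl
filter-∈-sublists P? (x ∷ xs) with P? x
... | yes _ = ∈-++⁺ˡ (∈-map⁺ (x ∷_) (filter-∈-sublists P? xs))
... | no  _ = ∈-++⁺ʳ (map (x ∷_) (sublists xs)) (filter-∈-sublists P? xs)

sublist-unique : ∀ {xs ys : List A} → Unique ys → xs ∈ sublists ys → Unique xs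
sublist-unique []                    (here ≡.refl) = []
sublist-unique {ys = y ∷ ys} (y∉ ∷ uys) xs∈ with ∈-++⁻ (map (y ∷_) (sublists ys)) xs∈
... | inj₂ xs∈ʳ = sublist-unique uys xs∈ʳ
... | inj₁ xs∈ˡ with ∈-map⁻ (y ∷_) xs∈ˡ
...   | zs , zs∈ , ≡.refl =
  All.tabulate (λ z∈ → All.lookup y∉ (∈-sublists⇒⊆ zs∈ z∈)) ∷ sublist-unique uys zs∈

sublists-unique : ∀ {xs : List A} → Unique xs → Unique (sublists xs)
sublists-unique []         = All.[] ∷ []
sublists-unique {xs = x ∷ xs} (x∉ ∷ uxs) = Unique.++⁺
  (Unique.map⁺ (λ { ≡.refl → ≡.refl }) (sublists-unique uxs)) (sublists-unique uxs)
  λ (ys∈ , ys∈′) → disjoint ys∈ ys∈′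
  where
  disjoint : ∀ {ys} → ys ∈ map (x ∷_) (sublists xs) → ¬ ys ∈ sublists xs
  disjoint ys∈ ys∈′ with ∈-map⁻ (x ∷_) ys∈
  ... | _ , _ , ≡.refl = All.lookup x∉ (∈-sublists⇒⊆ ys∈′ (here ≡.refl)) ≡.refl

-- A sublist of a repetition-free list keeps its order and so is determined by its elements;
-- agreement as sets becomes equality of lists.
sublist≡filter : ∀ {P : Pred A ℓ₃} (P? : Decidable P) {xs ys} → Unique xs → ys ∈ sublists xs →
                 (∀ {x} → x ∈ xs → x ∈ ys → P x) → (∀ {x} → x ∈ xs → P x → x ∈ ys) →
                 ys ≡ filter P? xs
sublist≡filter P? [] (here ≡.refl) _ _ = ≡.refl
sublist≡filter P? {x ∷ xs} (x∉ ∷ uxs) ys∈ to from with ∈-++⁻ (map (x ∷_) (sublists xs)) ys∈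
... | inj₁ ys∈ˡ with ∈-map⁻ (x ∷_) ys∈ˡ
...   | zs , zs∈ , ≡.refl with P? x
...     | no ¬px = contradiction (to (here ≡.refl) (here ≡.refl)) ¬px
...     | yes _  = ≡.cong (x ∷_) (sublist≡filter P? uxs zs∈
  (λ y∈ y∈zs → to (there y∈) (there y∈zs)) from′)
  where
  from′ : ∀ {y} → y ∈ xs → _ → y ∈ zs
  from′ y∈ py with from (there y∈) py
  ... | here ≡.refl = contradiction ≡.refl (All.lookup x∉ y∈)
  ... | there y∈zs  = y∈zs
sublist≡filter P? {x ∷ xs} (x∉ ∷ uxs) ys∈ to from | inj₂ ys∈ʳ with P? x
... | yes px = contradiction ≡.refl (All.lookup x∉ (∈-sublists⇒⊆ ys∈ʳ (from (here ≡.refl) px)))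
... | no _   = sublist≡filter P? uxs ys∈ʳ (to ∘ there) (from ∘ there)

antidiagList : (ℕ → ℕ → List A) → ℕ → List A
antidiagList φ zero    = φ 0 0
antidiagList φ (suc k) = φ 0 (suc k) ++ antidiagList (φ ∘ suc) k

∈-antidiagList⁺ : ∀ (φ : ℕ → ℕ → List A) i j {x} → x ∈ φ i j → x ∈ antidiagList φ (i ℕ.+ j)
∈-antidiagList⁺ φ zero    zero    x∈ = x∈
∈-antidiagList⁺ φ zero    (suc j) x∈ = ∈-++⁺ˡ x∈
∈-antidiagList⁺ φ (suc i) j       x∈ = ∈-++⁺ʳ (φ 0 (suc (i ℕ.+ j))) (∈-antidiagList⁺ (φ ∘ suc) i j x∈)

∈-antidiagList⁻ : ∀ (φ : ℕ → ℕ → List A) k {x} → x ∈ antidiagList φ k →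
                  ∃₂ λ i j → i ℕ.+ j ≡ k × x ∈ φ i j
∈-antidiagList⁻ φ zero    x∈ = 0 , 0 , ≡.refl , x∈
∈-antidiagList⁻ φ (suc k) x∈ with ∈-++⁻ (φ 0 (suc k)) x∈
... | inj₁ x∈₀ = 0 , suc k , ≡.refl , x∈₀
... | inj₂ x∈′ = let i , j , eq , x∈ᵢ = ∈-antidiagList⁻ (φ ∘ suc) k x∈′ in
  suc i , j , ≡.cong suc eq , x∈ᵢ

antidiagList-unique : ∀ (φ : ℕ → ℕ → List A) k → (∀ i j → Unique (φ i j)) →
                      (∀ {i j i′ j′ x} → x ∈ φ i j → x ∈ φ i′ j′ → i ≡ i′) →
                      Unique (antidiagList φ k)
antidiagList-unique φ zero    u sep = u 0 0
antidiagList-unique φ (suc k) u sep = Unique.++⁺ (u 0 (suc k))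
  (antidiagList-unique (φ ∘ suc) k (u ∘ suc) λ x∈ x∈′ → ℕ.suc-injective (sep x∈ x∈′))
  λ (x∈ , x∈′) → let _ , _ , _ , x∈ᵢ = ∈-antidiagList⁻ (φ ∘ suc) k x∈′ in
    contradiction (sep x∈ x∈ᵢ) λ ()

-- Binary trees as triangulated polygons.

data Tree : Set where
  leaf : Tree
  node : Tree → Tree → Tree

size : Tree → ℕ
size leaf       = 0
size (node l r) = suc (size l ℕ.+ size r)

-- A tree τ placed at a triangulates the polygon on the vertices a, …, end a τ:
-- a leaf is a single side, and node l r is the triangle on the base
-- (a, end a τ) together with l and r on its two other sides.
end : ℕ → Tree → ℕ
end a leaf       = suc a
end a (node l r) = end (end a l) r

end≡ : ∀ a τ → end a τ ≡ suc (size τ ℕ.+ a)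
end≡ a leaf       = ≡.refl
end≡ a (node l r) = ≡.trans (end≡ (end a l) r)
  (≡.trans (≡.cong (λ e → suc (size r ℕ.+ e)) (end≡ a l))
    (solve 3 (λ l r a → con 1 :+ (r :+ (con 1 :+ (l :+ a))) := con 1 :+ ((con 1 :+ (l :+ r)) :+ a))
      ≡.refl (size l) (size r) a))
  where open +-*-Solver

<-end : ∀ a τ → a < end a τ
<-end a leaf       = ℕ.≤-refl
<-end a (node l r) = ℕ.<-trans (<-end a l) (<-end (end a l) r)

-- Sides are included, as `top` of a leaf, so that the edges of a triangle need no distinction
-- between sides and diagonals.
data EdgeAt : ℕ → Tree → ℕ → ℕ → Set where
  top : ∀ {a τ} → EdgeAt a τ a (end a τ)
  inˡ : ∀ {a l r x z} → EdgeAt a l x z → EdgeAt a (node l r) x z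
  inʳ : ∀ {a l r x z} → EdgeAt (end a l) r x z → EdgeAt a (node l r) x z

edge-≥ : ∀ {a τ x z} → EdgeAt a τ x z → a ≤ x
edge-≥ top                 = ℕ.≤-refl
edge-≥ (inˡ p)             = edge-≥ p
edge-≥ {a} (inʳ {l = l} p) = ℕ.≤-trans (ℕ.<⇒≤ (<-end a l)) (edge-≥ p)

edge-≤ : ∀ {a τ x z} → EdgeAt a τ x z → z ≤ end a τ
edge-≤ top                         = ℕ.≤-refl
edge-≤ {a} (inˡ {l = l} {r = r} p) = ℕ.≤-trans (edge-≤ p) (ℕ.<⇒≤ (<-end (end a l) r))
edge-≤ (inʳ p)                     = edge-≤ p

edge-< : ∀ {a τ x z} → EdgeAt a τ x z → x < z
edge-< {a} {τ} top = <-end a τ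
edge-< (inˡ p)     = edge-< p
edge-< (inʳ p)     = edge-< p

edgeAt? : ∀ a τ x z → Dec (EdgeAt a τ x z)
edgeAt? a leaf x z =
  map′ (λ { (≡.refl , ≡.refl) → top }) (λ { top → ≡.refl , ≡.refl })
    ((x ℕ.≟ a) ×-dec (z ℕ.≟ suc a))
edgeAt? a (node l r) x z =
  map′ (λ { (inj₁ (≡.refl , ≡.refl)) → top ; (inj₂ (inj₁ p)) → inˡ p ; (inj₂ (inj₂ p)) → inʳ p })
       (λ { top → inj₁ (≡.refl , ≡.refl) ; (inˡ p) → inj₂ (inj₁ p) ; (inʳ p) → inj₂ (inj₂ p) })
    (((x ℕ.≟ a) ×-dec (z ℕ.≟ end a (node l r))) ⊎-dec edgeAt? a l x z ⊎-dec edgeAt? (end a l) r x z)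

restrictˡ : ∀ {a l r x z} → EdgeAt a (node l r) x z → z ≤ end a l → EdgeAt a l x z
restrictˡ {a} {l} {r} top z≤ = contradiction z≤ (ℕ.<⇒≱ (<-end (end a l) r))
restrictˡ (inˡ p)         z≤ = p
restrictˡ (inʳ p)         z≤ = contradiction (ℕ.≤-trans z≤ (edge-≥ p)) (ℕ.<⇒≱ (edge-< p))

restrictʳ : ∀ {a l r x z} → EdgeAt a (node l r) x z → end a l ≤ x → EdgeAt (end a l) r x z
restrictʳ {a} {l} top ≤x = contradiction ≤x (ℕ.<⇒≱ (<-end a l))
restrictʳ (inˡ p)     ≤x = contradiction (ℕ.≤-trans (edge-≤ p) ≤x) (ℕ.<⇒≱ (edge-< p))
restrictʳ (inʳ p)     ≤x = p

sideAt : ∀ a τ {x} → a ≤ x → x < end a τ → EdgeAt a τ x (suc x)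
sideAt a leaf a≤x x<e with ℕ.≤-antisym a≤x (ℕ.≤-pred x<e)
... | ≡.refl = top
sideAt a (node l r) {x} a≤x x<e with x ℕ.<? end a l
... | yes x<j = inˡ (sideAt a l a≤x x<j)
... | no  x≮j = inʳ (sideAt (end a l) r (ℕ.≮⇒≥ x≮j) x<e)

-- The base spans all vertices, and the two subtrees share only the apex, so a crossing pair would
-- lie within one subtree.
noncrossing : ∀ {a τ x z x′ z′} → EdgeAt a τ x z → EdgeAt a τ x′ z′ →
              x < x′ → x′ < z → ¬ z < z′
noncrossing top     q       x<x′ x′<z z<z′ = ℕ.<⇒≱ z<z′ (edge-≤ q)
noncrossing (inˡ p) top     x<x′ x′<z z<z′ = ℕ.<⇒≱ x<x′ (edge-≥ p)
noncrossing (inˡ p) (inˡ q) x<x′ x′<z z<z′ = noncrossing p q x<x′ x′<z z<z′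
noncrossing (inˡ p) (inʳ q) x<x′ x′<z z<z′ = ℕ.<⇒≱ x′<z (ℕ.≤-trans (edge-≤ p) (edge-≥ q))
noncrossing (inʳ p) q       x<x′ x′<z z<z′ =
  noncrossing p (restrictʳ q (ℕ.≤-trans (edge-≥ p) (ℕ.<⇒≤ x<x′))) x<x′ x′<z z<z′

-- Apart from the base, an edge from the left end stays left of the apex or reaches it, and an edge
-- to the right end starts at the apex or after it.
apex-unique : ∀ {a l r y} → EdgeAt a (node l r) a y →
              EdgeAt a (node l r) y (end a (node l r)) → y ≡ end a l
apex-unique top q = contradiction (edge-< q) (ℕ.<-irrefl ≡.refl)
apex-unique p@(inˡ _) top = contradiction (edge-< p) (ℕ.<-irrefl ≡.refl)
apex-unique {a} {l} {r} (inˡ _) (inˡ q) = contradiction (edge-≤ q) (ℕ.<⇒≱ (<-end (end a l) r))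
apex-unique (inˡ p) (inʳ q) = ℕ.≤-antisym (edge-≤ p) (edge-≥ q)
apex-unique {a} {l} (inʳ p) q = contradiction (edge-≥ p) (ℕ.<⇒≱ (<-end a l))

-- The apex of `τ` is joined to both ends of the base in `τ′` too, so the apexes agree. Edges can
-- then be restricted to either side of the common apex.
edges-injective : ∀ {a} τ τ′ → end a τ ≡ end a τ′ →
                  (∀ {x z} → EdgeAt a τ x z → EdgeAt a τ′ x z) → τ ≡ τ′
edges-injective leaf leaf _ _ = ≡.refl
edges-injective {a} leaf (node l r) eq _ =
  contradiction (ℕ.<-≤-trans (ℕ.s<s (<-end a l)) (<-end (end a l) r)) (ℕ.<-irrefl eq)
edges-injective {a} (node l r) leaf eq _ =
  contradiction (ℕ.<-≤-trans (ℕ.s<s (<-end a l)) (<-end (end a l) r)) (ℕ.<-irrefl (≡.sym eq))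
edges-injective {a} (node l r) (node l′ r′) eq sub
  with apex-unique {a} {l′} {r′} (sub (inˡ top))
         (≡.subst (EdgeAt a (node l′ r′) (end a l)) eq (sub (inʳ top)))
... | j≡j′ = ≡.cong₂ node
  (edges-injective l l′ j≡j′ λ p →
    restrictˡ (sub (inˡ p)) (ℕ.≤-trans (edge-≤ p) (ℕ.≤-reflexive j≡j′)))
  (edges-injective r r′ (≡.trans eq (≡.cong (λ j → end j r′) (≡.sym j≡j′))) λ {x} {z} p →
    ≡.subst (λ j → EdgeAt j r′ x z) (≡.sym j≡j′)
      (restrictʳ (sub (inʳ p)) (ℕ.≤-trans (ℕ.≤-reflexive (≡.sym j≡j′)) (edge-≥ p))))

trianglesAt : ℕ → Tree → List (ℕ × ℕ × ℕ)
trianglesAt a leaf       = []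
trianglesAt a (node l r) =
  (a , end a l , end a (node l r)) ∷ trianglesAt a l ++ trianglesAt (end a l) r

chordsAt : ℕ → Tree → List (ℕ × ℕ)
chordsAt a leaf       = []
chordsAt a (node l r) = (a , end a (node l r)) ∷ chordsAt a l ++ chordsAt (end a l) r

-- The recursion follows the long edge (x, z): the short edges lie in the same subtree, and once the
-- long edge is the base, y must be the apex.
∈-trianglesAt⁺ : ∀ {a τ x y z} → EdgeAt a τ x y → EdgeAt a τ y z → EdgeAt a τ x z →
                 (x , y , z) ∈ trianglesAt a τ
∈-trianglesAt⁺ {τ = leaf} p q top = contradiction (edge-< q) (ℕ.≤⇒≯ (edge-< p))
∈-trianglesAt⁺ {τ = node l r} p q top with apex-unique {l = l} {r} p q
... | ≡.refl = here ≡.refl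
∈-trianglesAt⁺ {τ = node l r} p q (inˡ s) = there (∈-++⁺ˡ
  (∈-trianglesAt⁺ (restrictˡ p (ℕ.≤-trans (ℕ.<⇒≤ (edge-< q)) (edge-≤ s))) (restrictˡ q (edge-≤ s)) s))
∈-trianglesAt⁺ {a} {node l r} p q (inʳ s) = there (∈-++⁺ʳ (trianglesAt a l)
  (∈-trianglesAt⁺ (restrictʳ p (edge-≥ s)) (restrictʳ q (ℕ.≤-trans (edge-≥ s) (ℕ.<⇒≤ (edge-< p)))) s))

∈-trianglesAt⁻ : ∀ {a} τ {x y z} → (x , y , z) ∈ trianglesAt a τ →
                 EdgeAt a τ x y × EdgeAt a τ y z × EdgeAt a τ x z
∈-trianglesAt⁻ (node l r) (here ≡.refl) = inˡ top , inʳ top , top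
∈-trianglesAt⁻ {a} (node l r) (there t∈) with ∈-++⁻ (trianglesAt a l) t∈
... | inj₁ t∈l = let p , q , s = ∈-trianglesAt⁻ l t∈l in inˡ p , inˡ q , inˡ s
... | inj₂ t∈r = let p , q , s = ∈-trianglesAt⁻ r t∈r in inʳ p , inʳ q , inʳ s

∈-chordsAt⁺ : ∀ {a τ x z} → EdgeAt a τ x z → ¬ z ≡ suc x → (x , z) ∈ chordsAt a τ
∈-chordsAt⁺ {τ = leaf} top z≢ = contradiction ≡.refl z≢
∈-chordsAt⁺ {τ = node l r} top z≢ = here ≡.refl
∈-chordsAt⁺ {τ = node l r} (inˡ p) z≢ = there (∈-++⁺ˡ (∈-chordsAt⁺ p z≢))
∈-chordsAt⁺ {a} {node l r} (inʳ p) z≢ = there (∈-++⁺ʳ (chordsAt a l) (∈-chordsAt⁺ p z≢))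

∈-chordsAt⁻ : ∀ {a} τ {x z} → (x , z) ∈ chordsAt a τ → EdgeAt a τ x z × suc x < z
∈-chordsAt⁻ {a} (node l r) (here ≡.refl) =
  top , ℕ.<-≤-trans (ℕ.s<s (<-end a l)) (<-end (end a l) r)
∈-chordsAt⁻ {a} (node l r) (there e∈) with ∈-++⁻ (chordsAt a l) e∈
... | inj₁ e∈l = let p , q = ∈-chordsAt⁻ l e∈l in inˡ p , q
... | inj₂ e∈r = let p , q = ∈-chordsAt⁻ r e∈r in inʳ p , q

-- A triangle is matched with its long edge, which transfers count and distinctness from chords to
-- triangles.
chordsAt≡ : ∀ a τ → map (λ (x , _ , z) → x , z) (trianglesAt a τ) ≡ chordsAt a τ
chordsAt≡ a leaf       = ≡.refl
chordsAt≡ a (node l r) = ≡.cong ((a , end a (node l r)) ∷_) (≡.trans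
  (List.map-++ _ (trianglesAt a l) _) (≡.cong₂ _++_ (chordsAt≡ a l) (chordsAt≡ (end a l) r)))

length-chordsAt : ∀ a τ → length (chordsAt a τ) ≡ size τ
length-chordsAt a leaf       = ≡.refl
length-chordsAt a (node l r) = ≡.cong suc (≡.trans (List.length-++ (chordsAt a l))
  (≡.cong₂ ℕ._+_ (length-chordsAt a l) (length-chordsAt (end a l) r)))

length-trianglesAt : ∀ a τ → length (trianglesAt a τ) ≡ size τ
length-trianglesAt a τ = ≡.trans (≡.sym (List.length-map _ (trianglesAt a τ)))
  (≡.trans (≡.cong length (chordsAt≡ a τ)) (length-chordsAt a τ))

chordsAt-unique : ∀ a τ → Unique (chordsAt a τ)
chordsAt-unique a leaf       = []
chordsAt-unique a (node l r) = All.tabulate base∉ ∷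
  Unique.++⁺ (chordsAt-unique a l) (chordsAt-unique (end a l) r) disjoint
  where
  base∉ : ∀ {e} → e ∈ chordsAt a l ++ chordsAt (end a l) r → ¬ (a , end a (node l r)) ≡ e
  base∉ e∈ ≡.refl with ∈-++⁻ (chordsAt a l) e∈
  ... | inj₁ e∈l = ℕ.<⇒≱ (<-end (end a l) r) (edge-≤ (proj₁ (∈-chordsAt⁻ l e∈l)))
  ... | inj₂ e∈r = ℕ.<⇒≱ (<-end a l) (edge-≥ (proj₁ (∈-chordsAt⁻ r e∈r)))
  disjoint : ∀ {e} → ¬ (e ∈ chordsAt a l × e ∈ chordsAt (end a l) r)
  disjoint (e∈l , e∈r) = let p , _ = ∈-chordsAt⁻ l e∈l ; q , _ = ∈-chordsAt⁻ r e∈r in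
    ℕ.<⇒≱ (edge-< p) (ℕ.≤-trans (edge-≤ p) (edge-≥ q))

trianglesAt-unique : ∀ a τ → Unique (trianglesAt a τ)
trianglesAt-unique a τ = Unique.map⁻ (≡.subst Unique (≡.sym (chordsAt≡ a τ)) (chordsAt-unique a τ))

-- Extending a noncrossing set of chords to a tree.

module Completion (E : ℕ → ℕ → Set) (E? : ∀ x z → Dec (E x z))
  (E-noncrossing : ∀ {x z x′ z′} → E x z → E x′ z′ → x < x′ → x′ < z → ¬ z < z′)
  where

  -- The index i stands for the vertex a + i + 1, the end of a left piece with i triangles. The
  -- default i = 0 is the side at a, which may be absent from `E`; the bound n stops just before the
  -- far end a + n + 2 of the base.
  lastEdge : ∀ a n → ∃ λ i → i ≤ n × (i ≡ 0 ⊎ E a (suc (i ℕ.+ a))) ×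
             (∀ m → i < m → m ≤ n → ¬ E a (suc (m ℕ.+ a)))
  lastEdge a zero = 0 , z≤n , inj₁ ≡.refl , λ { _ (s≤s _) () }
  lastEdge a (suc n) with E? a (suc (suc n ℕ.+ a))
  ... | yes e = suc n , ℕ.≤-refl , inj₂ e , λ m i<m m≤n → contradiction m≤n (ℕ.<⇒≱ i<m)
  ... | no ¬e with lastEdge a n
  ...   | i , i≤n , e , last = i , ℕ.m≤n⇒m≤1+n i≤n , e , last′
    where
    last′ : ∀ m → i < m → m ≤ suc n → ¬ E a (suc (m ℕ.+ a))
    last′ m i<m m≤1+n with ℕ.m≤n⇒m<n∨m≡n m≤1+n
    ... | inj₁ m<1+n  = last m i<m (ℕ.≤-pred m<1+n)
    ... | inj₂ ≡.refl = ¬e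

  -- A chord of `E` in neither piece passes over the apex. If it starts after a, it crosses the edge
  -- from a to the apex, or has no room to start when the apex is a + 1. If it starts at a, the
  -- choice of the last edge makes it the base.
  complete : ∀ fuel n a → n ≤ fuel → ∃ λ τ → size τ ≡ n ×
             (∀ {x z} → E x z → a ≤ x → x < z → z ≤ end a τ → EdgeAt a τ x z)
  complete fuel zero a _ = leaf , ≡.refl , λ _ a≤x x<z z≤ → cover a≤x x<z z≤
    where
    cover : ∀ {x z} → a ≤ x → x < z → z ≤ suc a → EdgeAt a leaf x z
    cover a≤x x<z z≤ with ℕ.≤-antisym a≤x (ℕ.≤-pred (ℕ.≤-trans x<z z≤))
    ... | ≡.refl with ℕ.≤-antisym z≤ x<z
    ...   | ≡.refl = top
  complete (suc fuel) (suc n) a (s≤s n≤fuel) with lastEdge a n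
  ... | i , i≤n , apex , last
    with complete fuel i a (ℕ.≤-trans i≤n n≤fuel)
  ...   | l , ≡.refl , cover-l
    with complete fuel (n ∸ size l) (end a l) (ℕ.≤-trans (ℕ.m∸n≤m n (size l)) n≤fuel)
  ...     | r , r≡ , cover-r =
    node l r , ≡.cong suc size≡ , cover
    where
    size≡ : size l ℕ.+ size r ≡ n
    size≡ = ≡.trans (≡.cong (size l ℕ.+_) r≡) (ℕ.m+[n∸m]≡n i≤n)

    cover : ∀ {x z} → E x z → a ≤ x → x < z → z ≤ end a (node l r) → EdgeAt a (node l r) x z
    cover {x} {z} e a≤x x<z z≤ with z ℕ.≤? end a l | end a l ℕ.≤? x
    ... | yes z≤j | _       = inˡ (cover-l e a≤x x<z z≤j)
    ... | no  _   | yes j≤x = inʳ (cover-r e j≤x x<z z≤)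
    ... | no  z≰j | no  j≰x with ℕ.m≤n⇒m<n∨m≡n a≤x
    cover {x} {z} e a≤x x<z z≤ | no z≰j | no j≰x | inj₁ a<x = ⊥-elim ([
      (λ l≡0 → ℕ.≤⇒≯ a<x (ℕ.<-≤-trans (ℕ.≰⇒> j≰x)
        (ℕ.≤-reflexive (≡.trans (end≡ a l) (≡.cong (λ i → suc (i ℕ.+ a)) l≡0))))) ,
      (λ eʲ → E-noncrossing (≡.subst (E a) (≡.sym (end≡ a l)) eʲ) e
        a<x (ℕ.≰⇒> j≰x) (ℕ.≰⇒> z≰j)) ]′ apex)
    cover {x} {z} e a≤x x<z z≤ | no z≰j | no j≰x | inj₂ ≡.refl with ℕ.m≤n⇒m<n∨m≡n z≤
    ... | inj₂ ≡.refl = top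
    ... | inj₁ z<e = ⊥-elim (last m i<m m≤n (≡.subst (E a) z≡ e))
      where
      m = z ∸ suc a
      z≡ : z ≡ suc (m ℕ.+ a)
      z≡ = ≡.trans (≡.sym (ℕ.m∸n+n≡m x<z)) (ℕ.+-suc m a)
      i<m : size l < m
      i<m = ℕ.+-cancelʳ-< a (size l) m (ℕ.≤-pred
        (≡.subst₂ _<_ (end≡ a l) z≡ (ℕ.≰⇒> z≰j)))
      m≤n : m ≤ n
      m≤n = ℕ.+-cancelʳ-≤ a m n (ℕ.≤-pred (ℕ.≤-pred (≡.subst₂ _<_ z≡
        (≡.trans (end≡ a (node l r)) (≡.cong (λ k → suc (suc (k ℕ.+ a))) size≡)) z<e)))

-- Enumeration of trees by size.

-- The first argument only bounds the recursion; the list is correct for k ≤ fuel.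
treesOfSize : ℕ → ℕ → List Tree
treesOfSize _          zero    = leaf ∷ []
treesOfSize zero       (suc k) = []
treesOfSize (suc fuel) (suc k) =
  antidiagList (λ i j → cartesianProductWith node (treesOfSize fuel i) (treesOfSize fuel j)) k

∈-treesOfSize⁺ : ∀ fuel τ → size τ ≤ fuel → τ ∈ treesOfSize fuel (size τ)
∈-treesOfSize⁺ _          leaf       _       = here ≡.refl
∈-treesOfSize⁺ (suc fuel) (node l r) (s≤s ≤) = ∈-antidiagList⁺ _ (size l) (size r)
  (∈-cartesianProductWith⁺ node
    (∈-treesOfSize⁺ fuel l (ℕ.m+n≤o⇒m≤o (size l) ≤))
    (∈-treesOfSize⁺ fuel r (ℕ.m+n≤o⇒n≤o (size l) ≤)))

∈-treesOfSize⁻ : ∀ fuel k {τ} → τ ∈ treesOfSize fuel k → size τ ≡ k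
∈-treesOfSize⁻ _          zero    (here ≡.refl) = ≡.refl
∈-treesOfSize⁻ (suc fuel) (suc k) τ∈
  with i , j , i+j≡k , τ∈ᵢⱼ ← ∈-antidiagList⁻ _ k τ∈
  with l , r , l∈ , r∈ , ≡.refl ← ∈-cartesianProductWith⁻ node (treesOfSize fuel i) (treesOfSize fuel j) τ∈ᵢⱼ
  = ≡.cong suc (≡.trans (≡.cong₂ ℕ._+_ (∈-treesOfSize⁻ fuel i l∈) (∈-treesOfSize⁻ fuel j r∈)) i+j≡k)

treesOfSize-unique : ∀ fuel k → Unique (treesOfSize fuel k)
treesOfSize-unique _          zero    = All.[] ∷ []
treesOfSize-unique zero       (suc k) = []
treesOfSize-unique (suc fuel) (suc k) = antidiagList-unique _ k
  (λ i j → Unique.cartesianProductWith⁺ node (λ { ≡.refl → ≡.refl , ≡.refl })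
    (treesOfSize-unique fuel i) (treesOfSize-unique fuel j))
  (λ {i} {j} {i′} {j′} → separate {i} {j} {i′} {j′})
  where
  separate : ∀ {i j i′ j′ τ} →
             τ ∈ cartesianProductWith node (treesOfSize fuel i) (treesOfSize fuel j) →
             τ ∈ cartesianProductWith node (treesOfSize fuel i′) (treesOfSize fuel j′) → i ≡ i′
  separate {i} {j} {i′} {j′} τ∈ τ∈′
    with l , r , l∈ , _ , ≡.refl ← ∈-cartesianProductWith⁻ node (treesOfSize fuel i) (treesOfSize fuel j) τ∈
    with _ , _ , l∈′ , _ , ≡.refl ← ∈-cartesianProductWith⁻ node (treesOfSize fuel i′) (treesOfSize fuel j′) τ∈′
    = ≡.trans (≡.sym (∈-treesOfSize⁻ fuel i l∈)) (∈-treesOfSize⁻ fuel i′ l∈′)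

length-antidiagList : ∀ (φ : ℕ → ℕ → List A) k →
  length (antidiagList φ k) ≡ ℕ-Antidiagonal.antidiag (λ i j → length (φ i j)) k
length-antidiagList φ zero    = ≡.refl
length-antidiagList φ (suc k) = ≡.trans (List.length-++ (φ 0 (suc k)))
  (≡.cong (length (φ 0 (suc k)) ℕ.+_) (length-antidiagList (φ ∘ suc) k))

length-cartesianProductWith : ∀ (f : A → B → D) xs ys →
  length (cartesianProductWith f xs ys) ≡ length xs ℕ.* length ys
length-cartesianProductWith f []       ys = ≡.refl
length-cartesianProductWith f (x ∷ xs) ys = ≡.trans (List.length-++ (map (f x) ys))
  (≡.cong₂ ℕ._+_ (List.length-map (f x) ys) (length-cartesianProductWith f xs ys))

length-treesOfSize : ∀ fuel k → k ≤ fuel → length (treesOfSize fuel k) ≡ catalan k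
length-treesOfSize _          zero    _        = ≡.refl
length-treesOfSize (suc fuel) (suc k) (s≤s k≤) = begin
  length (treesOfSize (suc fuel) (suc k))
    ≡⟨ length-antidiagList _ k ⟩
  _ ≡⟨ ℕ-Antidiagonal.antidiag-cong k (λ { i j ≡.refl → ≡.trans
         (length-cartesianProductWith node (treesOfSize fuel i) (treesOfSize fuel j))
         (≡.cong₂ ℕ._*_ (length-treesOfSize fuel i (ℕ.m+n≤o⇒m≤o i k≤))
           (length-treesOfSize fuel j (ℕ.m+n≤o⇒n≤o i k≤))) }) ⟩
  (catalan ℕ-Antidiagonal.⋆ catalan) k
    ≡⟨ catalan-suc k ⟨
  catalan (suc k) ∎
  where open ≡.≡-Reasoning

-- Summing weights over all trees of a given size.

module TreeSums {a ℓ} (R : CommutativeRing a ℓ) (w half : CommutativeRing.Carrier R)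
  (half+half≈1 : CommutativeRing._≈_ R (CommutativeRing._+_ R half half) (CommutativeRing.1# R))
  where

  open CommutativeRing R
  open import Relation.Binary.Reasoning.Setoid setoid
  open Antidiagonal commutativeSemiring
  open Weights R w half half+half≈1
  open import Algebra.Solver.Ring.NaturalCoefficients.Default commutativeSemiring
    using (solve; con; _:+_; _:*_; _:=_)

  ∑ : List Carrier → Carrier
  ∑ = foldr _+_ 0#

  ∑-++ : ∀ xs ys → ∑ (xs ++ ys) ≈ ∑ xs + ∑ ys
  ∑-++ []       ys = sym (+-identityˡ _)
  ∑-++ (x ∷ xs) ys = trans (+-congˡ (∑-++ xs ys)) (sym (+-assoc _ _ _))

  ∑-map-++ : ∀ {A : Set} (h : A → Carrier) xs ys →
             ∑ (map h (xs ++ ys)) ≈ ∑ (map h xs) + ∑ (map h ys)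
  ∑-map-++ h xs ys = trans (reflexive (≡.cong ∑ (List.map-++ h xs ys))) (∑-++ (map h xs) (map h ys))

  ∑-↭ : ∀ {xs ys} → xs ↭ ys → ∑ xs ≈ ∑ ys
  ∑-↭ ↭.refl         = refl
  ∑-↭ (↭.prep x p)   = +-congˡ (∑-↭ p)
  ∑-↭ (↭.swap x y p) = trans (+-congˡ (+-congˡ (∑-↭ p)))
    (trans (sym (+-assoc x y _)) (trans (+-congʳ (+-comm x y)) (+-assoc y x _)))
  ∑-↭ (↭.trans p q)  = trans (∑-↭ p) (∑-↭ q)

  ∑-cong : ∀ {A : Set} {g h : A → Carrier} xs → (∀ {x} → x ∈ xs → g x ≈ h x) →
           ∑ (map g xs) ≈ ∑ (map h xs)
  ∑-cong []       g≈h = refl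
  ∑-cong (x ∷ xs) g≈h = +-cong (g≈h (here ≡.refl)) (∑-cong xs (g≈h ∘ there))

  ∑-antidiagList : ∀ {A : Set} (h : A → Carrier) φ k →
    ∑ (map h (antidiagList φ k)) ≈ antidiag (λ i j → ∑ (map h (φ i j))) k
  ∑-antidiagList h φ zero    = refl
  ∑-antidiagList h φ (suc k) =
    trans (∑-map-++ h (φ 0 (suc k)) _) (+-congˡ (∑-antidiagList h (φ ∘ suc) k))

  ∑-shift : ∀ {A : Set} (h q : A → Carrier) x ys → (∀ {y} → y ∈ ys → h y ≈ x + q y) →
            ∑ (map h ys) ≈ ι (length ys) * x + ∑ (map q ys)
  ∑-shift h q x []       h≈ = solve 1 (λ x → con 0 := con 0 :* x :+ con 0) refl x
  ∑-shift h q x (y ∷ ys) h≈ = begin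
    h y + ∑ (map h ys)
      ≈⟨ +-cong (h≈ (here ≡.refl)) (∑-shift h q x ys (h≈ ∘ there)) ⟩
    x + q y + (ι (length ys) * x + ∑ (map q ys))
      ≈⟨ solve 4 (λ x y n z → x :+ y :+ (n :* x :+ z) := (con 1 :+ n) :* x :+ (y :+ z))
           refl x (q y) (ι (length ys)) (∑ (map q ys)) ⟩
    (1# + ι (length ys)) * x + (q y + ∑ (map q ys))
      ≈⟨ +-congʳ (*-congʳ (ι-+ 1 (length ys))) ⟨
    ι (suc (length ys)) * x + (q y + ∑ (map q ys)) ∎

  ∑-cartesianProductWith : ∀ {A B C : Set} (f : A → B → C) (h : C → Carrier) x p q xs ys →
    (∀ {y z} → y ∈ xs → z ∈ ys → h (f y z) ≈ x + (p y + q z)) →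
    ∑ (map h (cartesianProductWith f xs ys)) ≈
      x * (ι (length xs) * ι (length ys)) +
      (∑ (map p xs) * ι (length ys) + ι (length xs) * ∑ (map q ys))
  ∑-cartesianProductWith f h x p q []       ys h≈ =
    solve 3 (λ x n z → con 0 := x :* (con 0 :* n) :+ (con 0 :* n :+ con 0 :* z)) refl
      x (ι (length ys)) (∑ (map q ys))
  ∑-cartesianProductWith f h x p q (y ∷ xs) ys h≈ = begin
    ∑ (map h (map (f y) ys ++ cartesianProductWith f xs ys))
      ≈⟨ ∑-map-++ h (map (f y) ys) _ ⟩
    ∑ (map h (map (f y) ys)) + ∑ (map h (cartesianProductWith f xs ys))
      ≈⟨ +-cong
           (trans (reflexive (≡.cong ∑ (≡.sym (List.map-∘ ys))))
             (∑-shift (λ z → h (f y z)) q (x + p y) ys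
               λ z∈ → trans (h≈ (here ≡.refl) z∈) (sym (+-assoc x (p y) _))))
           (∑-cartesianProductWith f h x p q xs ys (h≈ ∘ there)) ⟩
    n * (x + p y) + Q + (x * (m * n) + (P * n + m * Q))
      ≈⟨ solve 6 (λ x y m n P Q → n :* (x :+ y) :+ Q :+ (x :* (m :* n) :+ (P :* n :+ m :* Q)) :=
           x :* ((con 1 :+ m) :* n) :+ ((y :+ P) :* n :+ (con 1 :+ m) :* Q)) refl x (p y) m n P Q ⟩
    x * ((1# + m) * n) + ((p y + P) * n + (1# + m) * Q)
      ≈⟨ +-cong (*-congˡ (*-congʳ (ι-+ 1 (length xs)))) (+-congˡ (*-congʳ (ι-+ 1 (length xs)))) ⟨
    x * (ι (suc (length xs)) * n) + ((p y + P) * n + ι (suc (length xs)) * Q) ∎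
    where
    m = ι (length xs)
    n = ι (length ys)
    P = ∑ (map p xs)
    Q = ∑ (map q ys)

  ∑-upTo : ∀ (h : ℕ → Carrier) φ k → (∀ i → i ≤ k → h i ≈ φ i (k ∸ i)) →
           ∑ (map h (upTo (suc k))) ≈ antidiag φ k
  ∑-upTo h φ k h≈ = trans (reflexive (≡.cong ∑ (List.map-upTo h (suc k)))) (applyUpTo≈ h φ k h≈)
    where
    applyUpTo≈ : ∀ (h : ℕ → Carrier) φ k → (∀ i → i ≤ k → h i ≈ φ i (k ∸ i)) →
                 ∑ (applyUpTo h (suc k)) ≈ antidiag φ k
    applyUpTo≈ h φ zero    h≈ = trans (+-identityʳ _) (h≈ 0 z≤n)
    applyUpTo≈ h φ (suc k) h≈ = +-cong (h≈ 0 z≤n) (applyUpTo≈ (h ∘ suc) (φ ∘ suc) k λ i i≤k → h≈ (suc i) (s≤s i≤k))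

  innerWeight : Tree → Carrier
  innerWeight leaf       = 0#
  innerWeight (node l r) = inner (size l) (size r) + (innerWeight l + innerWeight r)

  -- Serves sub-polygons with `inner` and the whole polygon with `outer`: in both cases the subtrees
  -- lie on proper sub-polygons and carry inner weights.
  ∑-node : ∀ fuel k (φ : ℕ → ℕ → Carrier) (h : Tree → Carrier) → k ≤ fuel →
    (∀ i → i ≤ k → ∑ (map innerWeight (treesOfSize fuel i)) ≈ s i) →
    (∀ l r → size l ℕ.+ size r ≡ k →
      h (node l r) ≈ φ (size l) (size r) + (innerWeight l + innerWeight r)) →
    ∑ (map h (treesOfSize (suc fuel) (suc k))) ≈ baseSum φ k
  ∑-node fuel k φ h k≤ ∑≈s h≈ = trans (∑-antidiagList h _ k) (antidiag-cong k λ { i j ≡.refl →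
    trans
      (∑-cartesianProductWith node h (φ i j) innerWeight innerWeight (treesOfSize fuel i) (treesOfSize fuel j)
        λ {l} {r} l∈ r∈ → let l≡ = ∈-treesOfSize⁻ fuel i l∈ ; r≡ = ∈-treesOfSize⁻ fuel j r∈ in
          trans (h≈ l r (≡.cong₂ ℕ._+_ l≡ r≡)) (+-congʳ (reflexive (≡.cong₂ φ l≡ r≡))))
      (let
        i≤ = ℕ.m≤m+n i j
        j≤ = ℕ.m≤n+m j i
        ci = reflexive (≡.cong ι (length-treesOfSize fuel i (ℕ.≤-trans i≤ k≤)))
        cj = reflexive (≡.cong ι (length-treesOfSize fuel j (ℕ.≤-trans j≤ k≤)))
      in +-cong (*-congˡ (*-cong ci cj)) (+-cong (*-cong (∑≈s i i≤) cj) (*-cong ci (∑≈s j j≤)))) })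

  ∑-innerWeight : ∀ fuel k → k ≤ fuel → ∑ (map innerWeight (treesOfSize fuel k)) ≈ s k
  ∑-innerWeight _          zero    _        = +-identityˡ 0#
  ∑-innerWeight (suc fuel) (suc k) (s≤s k≤) = trans
    (∑-node fuel k inner innerWeight k≤ (λ i i≤k → ∑-innerWeight fuel i (ℕ.≤-trans i≤k k≤)) λ _ _ _ → refl)
    (sym (s-suc-baseSum k))

  -- The disjunction in `g-inner` says that the base of the piece is not (0, N), in a form that
  -- passes to both subtrees.
  module _ (N : ℕ) (g : ℕ × ℕ × ℕ → Carrier)
    (g-inner : ∀ a l r → 0 < a ⊎ end a (node l r) < N → end a (node l r) ≤ N →
      g (a , end a l , end a (node l r)) ≈ inner (size l) (size r))
    (g-outer : ∀ l r → end 0 (node l r) ≡ N →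
      g (0 , end 0 l , N) ≈ outer (size l) (size r))
    where

    weightAt : ℕ → Tree → Carrier
    weightAt a τ = ∑ (map g (trianglesAt a τ))

    weightAt-inner : ∀ a τ → 0 < a ⊎ end a τ < N → end a τ ≤ N → weightAt a τ ≈ innerWeight τ
    weightAt-inner a leaf       _      _   = refl
    weightAt-inner a (node l r) proper end≤ = +-cong (g-inner a l r proper end≤)
      (trans (∑-map-++ g (trianglesAt a l) _) (+-cong
        (weightAt-inner a l (inj₂ l<N) (ℕ.<⇒≤ l<N))
        (weightAt-inner (end a l) r (inj₁ (ℕ.≤-<-trans z≤n (<-end a l))) end≤)))
      where
      l<N : end a l < N
      l<N = ℕ.<-≤-trans (<-end (end a l) r) end≤

    weightAt-outer : ∀ l r → end 0 (node l r) ≡ N →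
      weightAt 0 (node l r) ≈ outer (size l) (size r) + (innerWeight l + innerWeight r)
    weightAt-outer l r ≡.refl = +-cong (g-outer l r ≡.refl)
      (trans (∑-map-++ g (trianglesAt 0 l) _) (+-cong
        (weightAt-inner 0 l (inj₂ l<N) (ℕ.<⇒≤ l<N))
        (weightAt-inner (end 0 l) r (inj₁ (<-end 0 l)) ℕ.≤-refl)))
      where
      l<N : end 0 l < N
      l<N = <-end (end 0 l) r

    ∑-weightAt : ∀ k → N ≡ suc (suc k) →
      ∑ (map (weightAt 0) (treesOfSize (suc k) (suc k))) ≈ baseSum outer k
    ∑-weightAt k ≡.refl = ∑-node k k outer (weightAt 0) ℕ.≤-refl (∑-innerWeight k) λ { l r ≡.refl →
      weightAt-outer l r (≡.trans (end≡ 0 (node l r)) (≡.cong suc (ℕ.+-identityʳ _))) }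

-- Triangulations of the polygon correspond to trees.

toℕ² : ∀ {n} → Chord n → ℕ × ℕ
toℕ² (i , k) = toℕ i , toℕ k

toℕ³ : ∀ {n} → Triple n → ℕ × ℕ × ℕ
toℕ³ (l , j , r) = toℕ l , toℕ j , toℕ r

,-injective : ∀ {A B : Set} {x x′ : A} {y y′ : B} → (x , y) ≡ (x′ , y′) → x ≡ x′ × y ≡ y′
,-injective ≡.refl = ≡.refl , ≡.refl

toℕ²-injective : ∀ {n} {e e′ : Chord n} → toℕ² e ≡ toℕ² e′ → e ≡ e′
toℕ²-injective eq = let p , q = ,-injective eq in
  ≡.cong₂ _,_ (Fin.toℕ-injective p) (Fin.toℕ-injective q)

toℕ³-injective : ∀ {n} {t t′ : Triple n} → toℕ³ t ≡ toℕ³ t′ → t ≡ t′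
toℕ³-injective eq = let p , q = ,-injective eq in
  ≡.cong₂ _,_ (Fin.toℕ-injective p) (toℕ²-injective q)

diagonals-unique : ∀ n → Unique (diagonals n)
diagonals-unique n =
  Unique.filter⁺ isDiagonal? (Unique.cartesianProduct⁺ (Unique.allFin⁺ n) (Unique.allFin⁺ n))

∈-diagonals⁺ : ∀ {n} {e : Chord n} → IsDiagonal e → e ∈ diagonals n
∈-diagonals⁺ d = ∈-filter⁺ isDiagonal? (∈-cartesianProduct⁺ (∈-allFin _) (∈-allFin _)) d

∈-diagonals⁻ : ∀ {n} {e : Chord n} → e ∈ diagonals n → IsDiagonal e
∈-diagonals⁻ {n} e∈ = proj₂ (∈-filter⁻ isDiagonal? {xs = cartesianProduct (allFin n) (allFin n)} e∈)

private
  ordered? : ∀ {n} → Decidable (λ ((l , j , r) : Triple n) → l Fin.< j × j Fin.< r)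
  ordered? (l , j , r) = (l Fin.<? j) ×-dec (j Fin.<? r)

triples-unique : ∀ n → Unique (triples n)
triples-unique n = Unique.filter⁺ ordered? (Unique.cartesianProduct⁺ (Unique.allFin⁺ n)
  (Unique.cartesianProduct⁺ (Unique.allFin⁺ n) (Unique.allFin⁺ n)))

∈-triples⁺ : ∀ {n} {l j r : Fin n} → l Fin.< j → j Fin.< r → (l , j , r) ∈ triples n
∈-triples⁺ p q = ∈-filter⁺ ordered?
  (∈-cartesianProduct⁺ (∈-allFin _) (∈-cartesianProduct⁺ (∈-allFin _) (∈-allFin _))) (p , q)

∈-triangles⁻ : ∀ {n} {T : List (Chord n)} {l j r} → (l , j , r) ∈ triangles T →
               l Fin.< j × j Fin.< r × TriangleOf T (l , j , r)
∈-triangles⁻ {n} {T} t∈ with ∈-filter⁻ (triangleOf? T) {xs = triples n} t∈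
... | t∈′ , tri with ∈-filter⁻ ordered?
        {xs = cartesianProduct (allFin n) (cartesianProduct (allFin n) (allFin n))} t∈′
...   | _ , p , q = p , q , tri

-- Filtering the fixed list of diagonals yields the one order in which `sublists` lists this set.
fromTree : ∀ n → Tree → List (Chord n)
fromTree n τ = filter (λ (i , k) → edgeAt? 0 τ (toℕ i) (toℕ k)) (diagonals n)

module _ {n} (τ : Tree) (end≡n : suc (end 0 τ) ≡ n) where

  private
    T : List (Chord n)
    T = fromTree n τ

    TreeEdge : Chord n → Set
    TreeEdge (i , k) = EdgeAt 0 τ (toℕ i) (toℕ k)

    treeEdge? : Decidable TreeEdge
    treeEdge? (i , k) = edgeAt? 0 τ (toℕ i) (toℕ k)

    vertex : ∀ {x} → x ≤ end 0 τ → ∃ λ (i : Fin n) → toℕ i ≡ x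
    vertex x≤ = let x<n = ≡.subst (_ <_) end≡n (s≤s x≤) in fromℕ< x<n , Fin.toℕ-fromℕ< x<n

  ∈-fromTree⁻ : ∀ {e} → e ∈ fromTree n τ → IsDiagonal e × TreeEdge e
  ∈-fromTree⁻ e∈ = let e∈′ , p = ∈-filter⁻ treeEdge? {xs = diagonals n} e∈ in ∈-diagonals⁻ e∈′ , p

  side⇒treeEdge : ∀ {i k} → IsSide {n} (i , k) → TreeEdge (i , k)
  side⇒treeEdge {i} {k} (inj₁ k≡1+i) = ≡.subst (EdgeAt 0 τ (toℕ i)) (≡.sym k≡1+i)
    (sideAt 0 τ z≤n (ℕ.≤-pred (≡.subst₂ _<_ k≡1+i (≡.sym end≡n) (Fin.toℕ<n k))))
  side⇒treeEdge {i} {k} (inj₂ (i≡0 , 1+k≡n)) = ≡.subst₂ (EdgeAt 0 τ) (≡.sym i≡0)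
    (ℕ.suc-injective (≡.trans end≡n (≡.sym 1+k≡n))) top

  edge⇒treeEdge : ∀ {e} → Edge (fromTree n τ) e → TreeEdge e
  edge⇒treeEdge (inj₁ side) = side⇒treeEdge side
  edge⇒treeEdge (inj₂ e∈)   = proj₂ (∈-fromTree⁻ e∈)

  treeEdge⇒edge : ∀ {e} → TreeEdge e → Edge (fromTree n τ) e
  treeEdge⇒edge {e} p with isSide? e
  ... | yes side = inj₁ side
  ... | no ¬side = inj₂ (∈-filter⁺ treeEdge? (∈-diagonals⁺ (edge-< p , ¬side)) p)

  triangles-fromTree : map toℕ³ (triangles (fromTree n τ)) ↭ trianglesAt 0 τ
  triangles-fromTree = unique-⊆-⊇⇒↭
    (Unique.map⁺ toℕ³-injective (Unique.filter⁺ (triangleOf? T) (triples-unique n)))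
    (trianglesAt-unique 0 τ) to from
    where
    to : ∀ {t} → t ∈ map toℕ³ (triangles T) → t ∈ trianglesAt 0 τ
    to t∈ with ∈-map⁻ toℕ³ t∈
    ... | t′ , t′∈ , ≡.refl = let _ , _ , p , q , s = ∈-triangles⁻ {T = T} t′∈ in
      ∈-trianglesAt⁺ (edge⇒treeEdge p) (edge⇒treeEdge q) (edge⇒treeEdge s)
    from : ∀ {t} → t ∈ trianglesAt 0 τ → t ∈ map toℕ³ (triangles T)
    from {x , y , z} t∈ with ∈-trianglesAt⁻ τ t∈
    ... | p , q , s
      with vertex (ℕ.<⇒≤ (ℕ.<-≤-trans (edge-< p) (edge-≤ p))) | vertex (edge-≤ p) | vertex (edge-≤ q)
    ...   | l , ≡.refl | j , ≡.refl | r , ≡.refl = ∈-map⁺ toℕ³ (∈-filter⁺ (triangleOf? T)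
      (∈-triples⁺ (edge-< p) (edge-< q)) (treeEdge⇒edge p , treeEdge⇒edge q , treeEdge⇒edge s))

  -- The base (0, n - 1) is a side of the polygon, but a chord of the tree.
  base∷ : ∀ {U : List (Chord n)} → 2 ≤ end 0 τ → Unique U → (∀ {e} → e ∈ U → IsDiagonal e × TreeEdge e) →
          Unique ((0 , end 0 τ) ∷ map toℕ² U) ×
          (∀ {e} → e ∈ (0 , end 0 τ) ∷ map toℕ² U → e ∈ chordsAt 0 τ)
  base∷ {U} 2≤ u U⇒ = All.tabulate base∉ ∷ Unique.map⁺ toℕ²-injective u , sub
    where
    base∉ : ∀ {e} → e ∈ map toℕ² U → ¬ (0 , end 0 τ) ≡ e
    base∉ e∈ eq with ∈-map⁻ toℕ² e∈
    ... | e′ , e′∈ , ≡.refl = let p , q = ,-injective eq in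
      proj₂ (proj₁ (U⇒ e′∈)) (inj₂ (≡.sym p , ≡.trans (≡.cong suc (≡.sym q)) end≡n))
    sub : ∀ {e} → e ∈ (0 , end 0 τ) ∷ map toℕ² U → e ∈ chordsAt 0 τ
    sub (here ≡.refl) = ∈-chordsAt⁺ {0} {τ} top (λ eq → ℕ.<⇒≱ 2≤ (ℕ.≤-reflexive eq))
    sub (there e∈) with ∈-map⁻ toℕ² e∈
    ... | e′ , e′∈ , ≡.refl = let (_ , ¬side) , p = U⇒ e′∈ in ∈-chordsAt⁺ p (¬side ∘ inj₁)

  fromTree-unique : Unique (fromTree n τ)
  fromTree-unique = Unique.filter⁺ treeEdge? (diagonals-unique n)

  chords-fromTree : 2 ≤ end 0 τ → (0 , end 0 τ) ∷ map toℕ² (fromTree n τ) ↭ chordsAt 0 τ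
  chords-fromTree 2≤ = let u , sub = base∷ 2≤ fromTree-unique ∈-fromTree⁻ in
    unique-⊆-⊇⇒↭ u (chordsAt-unique 0 τ) sub sup
    where
    sup : ∀ {e} → e ∈ chordsAt 0 τ → e ∈ (0 , end 0 τ) ∷ map toℕ² T
    sup {x , z} e∈ with ∈-chordsAt⁻ τ e∈
    ... | p , 1+x<z with vertex (ℕ.<⇒≤ (ℕ.<-≤-trans (edge-< p) (edge-≤ p))) | vertex (edge-≤ p)
    ...   | i , ≡.refl | k , ≡.refl with treeEdge⇒edge {i , k} p
    ...     | inj₁ (inj₁ k≡1+i) = contradiction (≡.sym k≡1+i) (ℕ.<⇒≢ 1+x<z)
    ...     | inj₁ (inj₂ (i≡0 , 1+k≡n)) = here (≡.cong₂ _,_ i≡0 (ℕ.suc-injective (≡.trans 1+k≡n (≡.sym end≡n))))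
    ...     | inj₂ ik∈ = there (∈-map⁺ toℕ² ik∈)

  fromTree-isTriangulation : 2 ≤ end 0 τ → IsTriangulation (fromTree n τ)
  fromTree-isTriangulation 2≤ = len , allPairs-tabulate noncross , tri
    where
    size≡ : suc (suc (size τ)) ≡ n
    size≡ = ≡.trans (≡.cong suc (≡.sym (≡.trans (end≡ 0 τ) (≡.cong suc (ℕ.+-identityʳ _))))) end≡n
    -- The tree has n - 2 chords, one of which is the base.
    len : length T ≡ n ∸ 3
    len = ≡.trans (≡.sym (List.length-map toℕ² T))
      (≡.trans (≡.cong (_∸ 1) (≡.trans (↭-length (chords-fromTree 2≤)) (length-chordsAt 0 τ)))
        (≡.cong (_∸ 3) size≡))
    tri : length (triangles T) ≡ n ∸ 2
    tri = ≡.trans (≡.sym (List.length-map toℕ³ (triangles T)))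
      (≡.trans (↭-length triangles-fromTree) (≡.trans (length-trianglesAt 0 τ) (≡.cong (_∸ 2) size≡)))
    noncross : ∀ {e e′} → e ∈ T → e′ ∈ T → ¬ Crossing e e′
    noncross e∈ e′∈ (inj₁ (p , q , s)) =
      noncrossing (proj₂ (∈-fromTree⁻ e∈)) (proj₂ (∈-fromTree⁻ e′∈)) p q s
    noncross e∈ e′∈ (inj₂ (p , q , s)) =
      noncrossing (proj₂ (∈-fromTree⁻ e′∈)) (proj₂ (∈-fromTree⁻ e∈)) p q s

fromTree-injective : ∀ {n} τ τ′ → suc (end 0 τ) ≡ n → suc (end 0 τ′) ≡ n →
                     fromTree n τ ≡ fromTree n τ′ → τ ≡ τ′
fromTree-injective {n} τ τ′ p p′ eq = edges-injective τ τ′ (ℕ.suc-injective (≡.trans p (≡.sym p′))) sub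
  where
  sub : ∀ {x z} → EdgeAt 0 τ x z → EdgeAt 0 τ′ x z
  sub {x} {z} e = ≡.subst₂ (EdgeAt 0 τ′) i≡ k≡
    (edge⇒treeEdge τ′ p′ (≡.subst (λ T → Edge T (i , k)) eq
      (treeEdge⇒edge τ p (≡.subst₂ (EdgeAt 0 τ) (≡.sym i≡) (≡.sym k≡) e))))
    where
    z<n : z < n
    z<n = ≡.subst (z <_) p (s≤s (edge-≤ e))
    x<n : x < n
    x<n = ℕ.<-trans (edge-< e) z<n
    i = fromℕ< x<n
    k = fromℕ< z<n
    i≡ : toℕ i ≡ x
    i≡ = Fin.toℕ-fromℕ< x<n
    k≡ : toℕ k ≡ z
    k≡ = Fin.toℕ-fromℕ< z<n

toTree : ∀ m {T : List (Chord (3 ℕ.+ m))} → T ∈ sublists (diagonals (3 ℕ.+ m)) → IsTriangulation T →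
         ∃ λ τ → size τ ≡ suc m × T ≡ fromTree (3 ℕ.+ m) τ
toTree m {T} T∈ (len , noncross , _) = τ , size≡ ,
  sublist≡filter _ (diagonals-unique n) T∈ (λ _ → T⇒edge) edge⇒T
  where
  n = 3 ℕ.+ m

  open DecMembership (≡-dec ℕ._≟_ ℕ._≟_) using (_∈?_)

  T⇒diagonal : ∀ {e} → e ∈ T → IsDiagonal e
  T⇒diagonal e∈ = ∈-diagonals⁻ (∈-sublists⇒⊆ T∈ e∈)

  -- `AllPairs` compares an element only with later ones; the remaining cases use that crossing is
  -- symmetric and irreflexive.
  crossing-free : ∀ {e e′} {U : List (Chord n)} → AllPairs (λ e e′ → ¬ Crossing e e′) U → e ∈ U → e′ ∈ U → ¬ Crossing e e′
  crossing-free (x ∷ xs) (here ≡.refl) (here ≡.refl) (inj₁ (p , _ , _)) = ℕ.<-irrefl ≡.refl p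
  crossing-free (x ∷ xs) (here ≡.refl) (here ≡.refl) (inj₂ (p , _ , _)) = ℕ.<-irrefl ≡.refl p
  crossing-free (x ∷ xs) (here ≡.refl) (there e′∈) c = All.lookup x e′∈ c
  crossing-free (x ∷ xs) (there e∈) (here ≡.refl) (inj₁ c) = All.lookup x e∈ (inj₂ c)
  crossing-free (x ∷ xs) (there e∈) (here ≡.refl) (inj₂ c) = All.lookup x e∈ (inj₁ c)
  crossing-free (x ∷ xs) (there e∈) (there e′∈) c = crossing-free xs e∈ e′∈ c

  E-noncrossing : ∀ {x z x′ z′} → (x , z) ∈ map toℕ² T → (x′ , z′) ∈ map toℕ² T →
                  x < x′ → x′ < z → ¬ z < z′
  E-noncrossing e∈ e′∈ p q s with ∈-map⁻ toℕ² e∈ | ∈-map⁻ toℕ² e′∈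
  ... | _ , d∈ , ≡.refl | _ , d′∈ , ≡.refl = crossing-free noncross d∈ d′∈ (inj₁ (p , q , s))

  open Completion (λ x z → (x , z) ∈ map toℕ² T) (λ x z → (x , z) ∈? map toℕ² T) E-noncrossing

  completion = complete (suc m) (suc m) 0 ℕ.≤-refl
  τ = proj₁ completion

  size≡ : size τ ≡ suc m
  size≡ = proj₁ (proj₂ completion)

  end≡N : end 0 τ ≡ suc (suc m)
  end≡N = ≡.trans (end≡ 0 τ) (≡.cong suc (≡.trans (ℕ.+-identityʳ _) size≡))

  T⇒edge : ∀ {e} → e ∈ T → EdgeAt 0 τ (toℕ (proj₁ e)) (toℕ (proj₂ e))
  T⇒edge {i , k} e∈ = proj₂ (proj₂ completion) (∈-map⁺ toℕ² e∈) z≤n (proj₁ (T⇒diagonal e∈))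
    (ℕ.≤-trans (Fin.toℕ≤pred[n] k) (ℕ.≤-reflexive (≡.sym end≡N)))

  T-unique : Unique T
  T-unique = sublist-unique (diagonals-unique n) T∈

  -- With the base added, `T` has n - 2 elements, as many as the tree has chords, so the inclusion
  -- is a permutation.
  T↭ : (0 , end 0 τ) ∷ map toℕ² T ↭ chordsAt 0 τ
  T↭ = let u , sub = base∷ τ (≡.cong suc end≡N) (≡.subst (2 ≤_) (≡.sym end≡N) (s≤s (s≤s z≤n)))
                       T-unique (λ e∈ → T⇒diagonal e∈ , T⇒edge e∈) in
    unique-⊆-length⇒↭ u sub (ℕ.≤-reflexive (≡.trans (length-chordsAt 0 τ) (≡.trans size≡
      (≡.cong suc (≡.sym (≡.trans (List.length-map toℕ² T) len))))))

  edge⇒T : ∀ {e} → e ∈ diagonals n → EdgeAt 0 τ (toℕ (proj₁ e)) (toℕ (proj₂ e)) → e ∈ T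
  edge⇒T {i , k} e∈ p with ∈-diagonals⁻ e∈
  ... | _ , ¬side with ∈-resp-↭ (↭-sym T↭) (∈-chordsAt⁺ p (¬side ∘ inj₁))
  ...   | here eq  = let i≡0 , k≡ = ,-injective eq in
    contradiction (inj₂ (i≡0 , ≡.cong suc (≡.trans k≡ end≡N))) ¬side
  ...   | there ik∈ with ∈-map⁻ toℕ² ik∈
  ...     | _ , e′∈ , eq = ≡.subst (_∈ T) (≡.sym (toℕ²-injective eq)) e′∈

triangulations↭ : ∀ m → map (fromTree (3 ℕ.+ m)) (treesOfSize (suc m) (suc m)) ↭ triangulations (3 ℕ.+ m)
triangulations↭ m = unique-⊆-⊇⇒↭
  (unique-map-on (λ {τ} {τ′} τ∈ τ′∈ → fromTree-injective τ τ′ (end≡n τ τ∈) (end≡n τ′ τ′∈))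
    (treesOfSize-unique (suc m) (suc m)))
  (Unique.filter⁺ isTriangulation? (sublists-unique (diagonals-unique n)))
  to from
  where
  n = 3 ℕ.+ m
  end≡n : ∀ τ → τ ∈ treesOfSize (suc m) (suc m) → suc (end 0 τ) ≡ n
  end≡n τ τ∈ = ≡.cong suc (≡.trans (end≡ 0 τ)
    (≡.cong suc (≡.trans (ℕ.+-identityʳ _) (∈-treesOfSize⁻ (suc m) (suc m) τ∈))))
  to : ∀ {T} → T ∈ map (fromTree n) (treesOfSize (suc m) (suc m)) → T ∈ triangulations n
  to T∈ with ∈-map⁻ (fromTree n) T∈
  ... | τ , τ∈ , ≡.refl = ∈-filter⁺ isTriangulation? (filter-∈-sublists _ (diagonals n))
    (fromTree-isTriangulation τ (end≡n τ τ∈)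
      (≡.subst (2 ≤_) (≡.sym (ℕ.suc-injective (end≡n τ τ∈))) (s≤s (s≤s z≤n))))
  from : ∀ {T} → T ∈ triangulations n → T ∈ map (fromTree n) (treesOfSize (suc m) (suc m))
  from T∈ with ∈-filter⁻ isTriangulation? {xs = sublists (diagonals n)} T∈
  ... | T∈′ , tri with toTree m T∈′ tri
  ...   | τ , size≡ , ≡.refl = ∈-map⁺ (fromTree n)
    (≡.subst (λ k → τ ∈ treesOfSize (suc m) k) size≡ (∈-treesOfSize⁺ (suc m) τ (ℕ.≤-reflexive size≡)))

-- Rational reciprocals, and the sides of a triangle on the perimeter.

private
  k/1 : ℕ → ℚ
  k/1 k = mkℚ (+ k) 0 (coprime-sym (1-coprimeTo k))

/1≡k/1 : ∀ k → + k ℚ./ 1 ≡ k/1 k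
/1≡k/1 k = ℚ.↥p/↧p≡p (k/1 k)

/1-suc : ∀ k → + suc k ℚ./ 1 ≡ 1ℚ ℚ.+ (+ k ℚ./ 1)
/1-suc k = ≡.trans (≡.cong (λ m → (+ m) ℚ./ 1) (≡.cong suc (≡.sym (ℕ.*-identityʳ k))))
  (≡.trans (≡.cong (ℚ._/ 1) lemma) (≡.cong (λ q → 1ℚ ℚ.+ q) (≡.sym (/1≡k/1 k))))
  where
  lemma : (+ suc (k ℕ.* 1)) ≡ ((+ 1) ℤ.* (+ 1)) ℤ.+ ((+ k) ℤ.* (+ 1))
  lemma = ≡.cong (λ z → (+ 1) ℤ.+ z) (ℤ.pos-* k 1)

suc*1/suc : ∀ d → (+ suc d ℚ./ 1) ℚ.* (+ 1 ℚ./ suc d) ≡ 1ℚ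
suc*1/suc d = ≡.trans (≡.cong₂ ℚ._*_ (/1≡k/1 (suc d)) (ℚ.↥p/↧p≡p (ℚ.1/ k/1 (suc d))))
  (ℚ.*-inverseʳ (k/1 (suc d)))

length-filter-∷ : ∀ {A : Set} {P : A → Set} (P? : Decidable P) x xs →
  length (filter P? (x ∷ xs)) ≡ (if does (P? x) then 1 else 0) ℕ.+ length (filter P? xs)
length-filter-∷ P? x xs with does (P? x)
... | true  = ≡.refl
... | false = ≡.refl

isZero : ℕ → ℕ
isZero zero    = 1
isZero (suc _) = 0

base? : ∀ N x z → Dec (x ≡ 0 × z ≡ N)
base? N x z = (x ℕ.≟ 0) ×-dec (z ℕ.≟ N)

-- The short edges cannot be the base, so they are sides exactly when their gap is empty; the long
-- edge skips j and is a side only as the base.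
commonSides≡ : ∀ {N} (l j r : Fin (suc N)) → l Fin.< j → j Fin.< r →
  commonSides (l , j , r) ≡
    isZero (toℕ j ∸ suc (toℕ l)) ℕ.+ (isZero (toℕ r ∸ suc (toℕ j)) ℕ.+
      ((if does (base? N (toℕ l) (toℕ r)) then 1 else 0) ℕ.+ 0))
commonSides≡ {N} l j r l<j j<r = ≡.trans (length-filter-∷ isSide? (l , j) _)
  (≡.cong₂ ℕ._+_ (short l j l<j (λ (_ , 1+j≡n) → ℕ.<⇒≢ (ℕ.≤-<-trans j<r (Fin.toℕ<n r)) 1+j≡n))
    (≡.trans (length-filter-∷ isSide? (j , r) _)
      (≡.cong₂ ℕ._+_ (short j r j<r (λ (j≡0 , _) → ℕ.n≮0 (≡.subst (toℕ l <_) j≡0 l<j)))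
        (≡.trans (length-filter-∷ isSide? (l , r) []) (≡.cong (ℕ._+ 0) long)))))
  where
  short : ∀ (i k : Fin (suc N)) → i Fin.< k → ¬ (toℕ i ≡ 0 × suc (toℕ k) ≡ suc N) →
          (if does (isSide? (i , k)) then 1 else 0) ≡ isZero (toℕ k ∸ suc (toℕ i))
  short i k i<k ¬base with toℕ k ∸ suc (toℕ i) in eq
  ... | zero = ≡.cong (λ b → if b then 1 else 0) (dec-true (isSide? (i , k))
    (inj₁ (ℕ.≤-antisym (ℕ.m∸n≡0⇒m≤n eq) i<k)))
  ... | suc d = ≡.cong (λ b → if b then 1 else 0) (dec-false (isSide? (i , k)) λ
    { (inj₁ k≡) → ℕ.0≢1+n (≡.trans (≡.sym (ℕ.n∸n≡0 (suc (toℕ i))))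
        (≡.trans (≡.cong (_∸ suc (toℕ i)) (≡.sym k≡)) eq))
    ; (inj₂ base) → ¬base base })
  long : (if does (isSide? (l , r)) then 1 else 0) ≡ (if does (base? N (toℕ l) (toℕ r)) then 1 else 0)
  long = ≡.cong (λ b → if b then 1 else 0) (does-⇔ (mk⇔
    (λ { (inj₁ r≡1+l) → contradiction (≡.sym r≡1+l) (ℕ.<⇒≢ (ℕ.≤-<-trans l<j j<r))
       ; (inj₂ (l≡0 , 1+r≡n)) → l≡0 , ℕ.suc-injective 1+r≡n })
    (λ (l≡0 , r≡N) → inj₂ (l≡0 , ≡.cong suc r≡N)))
    (isSide? (l , r)) (base? N (toℕ l) (toℕ r)))

end∸ : ∀ a τ → end a τ ∸ suc a ≡ size τ
end∸ a τ = ≡.trans (≡.cong (_∸ suc a) (≡.trans (end≡ a τ) (≡.sym (ℕ.+-suc (size τ) a)))) (ℕ.m+n∸n≡m (size τ) (suc a))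

-- The expectation over an abstract ring.

record ArePowers {A : Set} (_≈_ : A → A → Set) (_*_ : A → A → A) (1# w : A) (w^ : ℕ → A) : Set where
  field
    w^0   : w^ 0 ≈ 1#
    w^suc : ∀ k → w^ (suc k) ≈ (w * w^ k)

-- Abstract in the operations, since unfolding those of ℂ exposes the Cauchy proofs inside ℝ.
module Expectation
  {Carrier : Set} {_≈_ : Carrier → Carrier → Set} {_+_ _*_ _-_ : Carrier → Carrier → Carrier}
  { -_ : Carrier → Carrier} {0# 1# : Carrier}
  (isCommutativeRing : IsCommutativeRing _≈_ _+_ _*_ -_ 0# 1#)
  (x-y≈x+-y : ∀ x y → (x - y) ≈ (x + (- y)))
  {q : ℚ → Carrier} {fromℕ : ℕ → Carrier} {_÷_ : Carrier → ℕ → Carrier}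
  (q-+ : ∀ x y → q (x ℚ.+ y) ≈ (q x + q y))
  (q-* : ∀ x y → q (x ℚ.* y) ≈ (q x * q y))
  (q-0 : q 0ℚ ≈ 0#) (q-1 : q 1ℚ ≈ 1#)
  (fromℕ≈q : ∀ k → fromℕ k ≈ q (+ k ℚ./ 1))
  (÷-suc : ∀ z d → (z ÷ suc d) ≈ (z * q (+ 1 ℚ./ suc d)))
  {w : Carrier} {w^ : ℕ → Carrier} (powers : ArePowers _≈_ _*_ 1# w w^)
  {f : ∀ {n} → Triple n → Carrier}
  (f≈ : ∀ {n} (l j r : Fin n) → f (l , j , r) ≈
    (if does (commonSides (l , j , r) ℕ.≟ 1) then ((w^ (toℕ j ∸ toℕ l) + w^ (toℕ r ∸ toℕ j)) ÷ 2) else 0#))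
  where

  open ArePowers powers

  R : CommutativeRing _ _
  R = record { isCommutativeRing = isCommutativeRing }

  module R = CommutativeRing R
  open import Relation.Binary.Reasoning.Setoid R.setoid
  open Mult R.semiring using (×-homo-+) renaming (_×_ to _·_)

  q[k/1]≈k·1 : ∀ k → q (+ k ℚ./ 1) R.≈ k · 1#
  q[k/1]≈k·1 zero    = q-0
  q[k/1]≈k·1 (suc k) = R.trans (R.reflexive (≡.cong q (/1-suc k)))
    (R.trans (q-+ 1ℚ (+ k ℚ./ 1)) (R.trans (R.+-cong q-1 (q[k/1]≈k·1 k)) (R.sym (×-homo-+ 1# 1 k))))

  half : Carrier
  half = q (+ 1 ℚ./ 2)

  half+half≈1 : half R.+ half R.≈ 1#
  half+half≈1 = R.trans (R.sym (q-+ (+ 1 ℚ./ 2) (+ 1 ℚ./ 2))) q-1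

  open Antidiagonal R.commutativeSemiring
  open Weights R w half half+half≈1
  open TreeSums R w half half+half≈1
  open Exp R.semiring using (_^_)

  w^≈ : ∀ k → w^ k R.≈ w ^ k
  w^≈ zero    = w^0
  w^≈ (suc k) = R.trans (w^suc k) (R.*-congˡ (w^≈ k))

  fromℕ≈ι : ∀ k → fromℕ k R.≈ ι k
  fromℕ≈ι k = R.trans (fromℕ≈q k) (q[k/1]≈k·1 k)

  -- Division is totalised at 0, so a divisor must be nonzero before it acts through an inverse.
  ÷-inverse : ∀ d → ¬ d ≡ 0 → ∃ λ L → ι d R.* L R.≈ 1# × (∀ z → (z ÷ d) R.≈ z R.* L)
  ÷-inverse zero    d≢0 = contradiction ≡.refl d≢0
  ÷-inverse (suc d) _   = q (+ 1 ℚ./ suc d) ,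
    R.trans (R.*-congʳ (R.sym (q[k/1]≈k·1 (suc d))))
      (R.trans (R.sym (q-* (+ suc d ℚ./ 1) (+ 1 ℚ./ suc d)))
        (R.trans (R.reflexive (≡.cong q (suc*1/suc d))) q-1)) ,
    λ z → ÷-suc z d

  -- For a triangle of a tree the two differences are the numbers of triangles in the pieces beyond
  -- its short edges.
  weight : ℕ → ℕ × ℕ × ℕ → Carrier
  weight N (x , y , z) = if does (base? N x z)
    then outer (y ∸ suc x) (z ∸ suc y) else inner (y ∸ suc x) (z ∸ suc y)

  weight-base : ∀ N x y z {b} → does (base? N x z) ≡ b → weight N (x , y , z) ≡
    (if b then outer (y ∸ suc x) (z ∸ suc y) else inner (y ∸ suc x) (z ∸ suc y))
  weight-base N x y z ≡.refl = ≡.refl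

  mean≈ : ∀ i j → ((w^ (suc i) + w^ (suc j)) ÷ 2) R.≈ mean i j
  mean≈ i j = R.trans (÷-suc _ 1) (R.*-congʳ (R.+-cong (w^≈ (suc i)) (w^≈ (suc j))))

  weight-cases : ∀ b i j →
    (if does (isZero i ℕ.+ (isZero j ℕ.+ ((if b then 1 else 0) ℕ.+ 0)) ℕ.≟ 1)
      then (w^ (suc i) + w^ (suc j)) ÷ 2 else 0#)
    R.≈ (if b then outer i j else inner i j)
  weight-cases true  zero    zero    = R.refl
  weight-cases true  zero    (suc j) = R.refl
  weight-cases true  (suc i) zero    = R.refl
  weight-cases true  (suc i) (suc j) = mean≈ (suc i) (suc j)
  weight-cases false zero    zero    = R.refl
  weight-cases false zero    (suc j) = mean≈ 0 (suc j)
  weight-cases false (suc i) zero    = mean≈ (suc i) 0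
  weight-cases false (suc i) (suc j) = R.refl

  f≈weight : ∀ {N} (l j r : Fin (suc N)) → l Fin.< j → j Fin.< r →
             f (l , j , r) R.≈ weight N (toℕ³ (l , j , r))
  f≈weight {N} l j r l<j j<r = R.trans (f≈ l j r) (R.trans
    (R.reflexive (≡.cong₂ (λ c x → if does (c ℕ.≟ 1) then x else 0#) (commonSides≡ l j r l<j j<r)
      (≡.cong₂ (λ p q → (w^ p + w^ q) ÷ 2) (gap l<j) (gap j<r))))
    (weight-cases (does (base? N (toℕ l) (toℕ r))) (toℕ j ∸ suc (toℕ l)) (toℕ r ∸ suc (toℕ j))))
    where
    gap : ∀ {x y} → x < y → y ∸ x ≡ suc (y ∸ suc x)
    gap x<y = ℕ.+-∸-assoc 1 x<y

  weight-inner : ∀ N a l r → 0 < a ⊎ end a (node l r) < N → end a (node l r) ≤ N →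
    weight N (a , end a l , end a (node l r)) R.≈ inner (size l) (size r)
  weight-inner N a l r proper _ = R.reflexive (≡.trans
    (weight-base N a (end a l) (end a (node l r)) (dec-false (base? N a (end a (node l r))) (¬base proper)))
    (≡.cong₂ inner (end∸ a l) (end∸ (end a l) r)))
    where
    ¬base : 0 < a ⊎ end a (node l r) < N → ¬ (a ≡ 0 × end a (node l r) ≡ N)
    ¬base (inj₁ 0<a) (a≡0 , _) = ℕ.<⇒≢ 0<a (≡.sym a≡0)
    ¬base (inj₂ e<N) (_ , e≡N) = ℕ.<⇒≢ e<N e≡N

  weight-outer : ∀ N l r → end 0 (node l r) ≡ N →
    weight N (0 , end 0 l , N) R.≈ outer (size l) (size r)
  weight-outer _ l r ≡.refl = R.reflexive (≡.trans
    (weight-base N 0 (end 0 l) N (dec-true (base? N 0 (end 0 (node l r))) (≡.refl , ≡.refl)))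
    (≡.cong₂ outer (end∸ 0 l) (end∸ (end 0 l) r)))
    where N = end 0 (node l r)

  totalWeight : ∀ {n} → List (Chord n) → Carrier
  totalWeight T = ∑ (map f (triangles T))

  totalWeight-fromTree : ∀ N τ → end 0 τ ≡ N →
    totalWeight (fromTree (suc N) τ) R.≈ ∑ (map (weight N) (trianglesAt 0 τ))
  totalWeight-fromTree N τ end≡N = R.trans
    (∑-cong (triangles T) λ {(l , j , r)} t∈ → let l<j , j<r , _ = ∈-triangles⁻ {T = T} t∈ in
      f≈weight l j r l<j j<r)
    (R.trans (R.reflexive (≡.cong ∑ (List.map-∘ (triangles T))))
      (∑-↭ (↭.map⁺ (weight N) (triangles-fromTree τ (≡.cong suc end≡N)))))
    where T = fromTree (suc N) τ

  ∑-triangulations : ∀ k →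
    ∑ (map (totalWeight) (triangulations (3 ℕ.+ k))) R.≈ baseSum outer k
  ∑-triangulations k = R.trans (∑-↭ (↭.map⁺ (totalWeight) (↭-sym (triangulations↭ k))))
    (R.trans (R.reflexive (≡.cong ∑ (≡.sym (List.map-∘ trees))))
      (R.trans (∑-cong trees λ {τ} τ∈ → totalWeight-fromTree N τ (≡.trans (end≡ 0 τ)
          (≡.cong suc (≡.trans (ℕ.+-identityʳ _) (∈-treesOfSize⁻ (suc k) (suc k) τ∈)))))
        (∑-weightAt N (weight N) (weight-inner N) (weight-outer N) k ≡.refl)))
    where
    N = 2 ℕ.+ k
    trees = treesOfSize (suc k) (suc k)

  length-triangulations : ∀ k → length (triangulations (3 ℕ.+ k)) ≡ catalan (suc k)
  length-triangulations k = ≡.trans (≡.sym (↭.↭-length (triangulations↭ k)))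
    (≡.trans (List.length-map _ (treesOfSize (suc k) (suc k))) (length-treesOfSize (suc k) (suc k) ℕ.≤-refl))

  catalan≢0 : ∀ k → ¬ catalan k ≡ 0
  catalan≢0 zero    ()
  catalan≢0 (suc k) eq with ℕ.m*n≡0⇒m≡0∨n≡0 (2 ℕ.* suc (2 ℕ.* k)) (≡.trans
    (≡.sym ([k+2]*catalan[k+1]≡2[2k+1]*catalan k)) (≡.trans (≡.cong (suc (suc k) ℕ.*_) eq) (ℕ.*-zeroʳ (suc (suc k)))))
  ... | inj₂ ck≡0 = catalan≢0 k ck≡0

  central≡ : ∀ {d} e j → d ≡ 2 ℕ.* e → (d ∸ 2 ℕ.* j) C (e ∸ j) ≡ central (e ∸ j)
  central≡ e j ≡.refl = ≡.cong (_C (e ∸ j)) (≡.sym (ℕ.*-distribˡ-∸ 2 e j))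

  term≈ : ∀ j {x y} → x ≡ y → ((w^ j * fromℕ (catalan j)) * fromℕ x) R.≈ v j R.* ι y
  term≈ j ≡.refl = R.*-cong (R.*-cong (w^≈ j) (fromℕ≈ι _)) (fromℕ≈ι _)

  expectation : ∀ (E : Carrier) (sumTo : ℕ → (ℕ → Carrier) → Carrier) n → 4 ≤ n →
    (∀ k g → sumTo k g ≈ foldr _+_ 0# (map g (upTo (suc k)))) →
    E ≈ (foldr _+_ 0# (map (λ T → foldr _+_ 0# (map f (triangles T))) (triangulations n))
          ÷ length (triangulations n)) →
    E ≈ (((- ((fromℕ (n ∸ 1) * ((fromℕ 2 * w^ (n ∸ 2)) + (fromℕ 3 * w))) ÷ (2 ℕ.* (2 ℕ.* n ∸ 5))))
          + (((fromℕ 3 * w) ÷ catalan (n ∸ 2))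
            * sumTo (n ∸ 3) (λ j → (w^ j * fromℕ (catalan j)) * fromℕ ((2 ℕ.* n ∸ 6 ∸ 2 ℕ.* j) C (n ∸ 3 ∸ j)))))
          - ((w ÷ (2 ℕ.* catalan (n ∸ 2)))
            * sumTo (n ∸ 3) (λ j → (w^ j * fromℕ (catalan j)) * fromℕ ((2 ℕ.* n ∸ 4 ∸ 2 ℕ.* j) C (n ∸ 2 ∸ j)))))
  expectation E sumTo _ (s≤s (s≤s (s≤s (s≤s {n = m} z≤n)))) sumTo≈ E≈ = R.trans E≈ (begin
    S ÷ length (triangulations n)
      ≡⟨ ≡.cong (S ÷_) (length-triangulations k) ⟩
    S ÷ catalan (suc k)
      ≈⟨ proj₂ (proj₂ inv-c) S ⟩
    S R.* L
      ≈⟨ R.*-congʳ (∑-triangulations k) ⟩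
    baseSum outer k R.* L
      ≈⟨ closedForm m L L₂ e (proj₁ (proj₂ inv-c)) (proj₁ (proj₂ inv-2c)) (proj₁ (proj₂ inv-q)) ⟩
    (R.- (ι (2 ℕ.+ k) R.* (ι 2 R.* w ^ suc k R.+ ι 3 R.* w) R.* e) R.+ ι 3 R.* w R.* L R.* (v ⋆ b) k)
      R.- w R.* L₂ R.* (v ⋆ (λ i → b (suc i))) k
      ≈⟨ R.+-cong (R.+-cong (R.-‿cong X≈) (R.*-cong Y≈ Σ₁≈)) (R.-‿cong (R.*-cong (proj₂ (proj₂ inv-2c) w) Σ₂≈)) ⟨
    ((- _) + _) + (- _)
      ≈⟨ x-y≈x+-y _ _ ⟨
    _ ∎)
    where
    -- This is n - 3, positive because n is at least 4, as `closedForm` requires.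
    k = suc m
    n = 3 ℕ.+ k
    S = ∑ (map totalWeight (triangulations n))
    Q = 2 ℕ.* (2 ℕ.* n ∸ 5)
    Q≡ : Q ≡ 2 ℕ.* suc (2 ℕ.* k)
    Q≡ = ≡.cong (λ x → 2 ℕ.* (x ∸ 5)) (solve 1 (λ k → con 2 :* (con 3 :+ k) := con 5 :+ (con 1 :+ con 2 :* k)) ≡.refl k)
      where open +-*-Solver
    inv-c = ÷-inverse (catalan (suc k)) (catalan≢0 (suc k))
    inv-2c = ÷-inverse (2 ℕ.* catalan (suc k)) λ eq → catalan≢0 (suc k) (ℕ.m+n≡0⇒m≡0 (catalan (suc k)) eq)
    inv-q = ÷-inverse (2 ℕ.* suc (2 ℕ.* k)) λ ()
    L = proj₁ inv-c
    L₂ = proj₁ inv-2c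
    e = proj₁ inv-q
    X≈ : ((fromℕ (n ∸ 1) * ((fromℕ 2 * w^ (n ∸ 2)) + (fromℕ 3 * w))) ÷ Q) R.≈
         ι (2 ℕ.+ k) R.* (ι 2 R.* w ^ suc k R.+ ι 3 R.* w) R.* e
    X≈ = R.trans (R.reflexive (≡.cong ((fromℕ (n ∸ 1) * ((fromℕ 2 * w^ (n ∸ 2)) + (fromℕ 3 * w))) ÷_) Q≡)) (R.trans (proj₂ (proj₂ inv-q) _)
      (R.*-congʳ (R.*-cong (fromℕ≈ι (2 ℕ.+ k))
        (R.+-cong (R.*-cong (fromℕ≈ι 2) (w^≈ (suc k))) (R.*-congʳ (fromℕ≈ι 3))))))
    Y≈ : ((fromℕ 3 * w) ÷ catalan (suc k)) R.≈ ι 3 R.* w R.* L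
    Y≈ = R.trans (proj₂ (proj₂ inv-c) _) (R.*-congʳ (R.*-congʳ (fromℕ≈ι 3)))
    2n∸6≡ : 2 ℕ.* n ∸ 6 ≡ 2 ℕ.* k
    2n∸6≡ = ≡.cong (_∸ 6) (ℕ.*-distribˡ-+ 2 3 k)
    2n∸4≡ : 2 ℕ.* n ∸ 4 ≡ 2 ℕ.* suc k
    2n∸4≡ = ≡.cong (_∸ 4) (ℕ.*-distribˡ-+ 2 2 (suc k))
    Σ₁≈ : sumTo k (λ j → (w^ j * fromℕ (catalan j)) * fromℕ ((2 ℕ.* n ∸ 6 ∸ 2 ℕ.* j) C (k ∸ j))) R.≈ (v ⋆ b) k
    Σ₁≈ = R.trans (sumTo≈ k _) (∑-upTo _ (λ i j → v i R.* b j) k λ j _ → term≈ j (central≡ k j 2n∸6≡))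
    -- The sum stops at n - 3, one term short of the convolution with `b` at n - 2; hence the
    -- shifted sequence.
    Σ₂≈ : sumTo k (λ j → (w^ j * fromℕ (catalan j)) * fromℕ ((2 ℕ.* n ∸ 4 ∸ 2 ℕ.* j) C (suc k ∸ j))) R.≈
          (v ⋆ (λ i → b (suc i))) k
    Σ₂≈ = R.trans (sumTo≈ k _) (∑-upTo _ (λ i j → v i R.* b (suc j)) k λ j j≤k → term≈ j
      (≡.trans (central≡ (suc k) j 2n∸4≡) (≡.cong central (ℕ.+-∸-assoc 1 j≤k))))

-- Specialisation to the complex numbers.

open import Defs

module ℂ = CommutativeRing ℂ-commutativeRing

-- Elements of ℝ carry Cauchy proofs, whose definitional comparison is infeasible; hence
-- equalities are reduced to the underlying sequences.
seq-≡⇒≈ : ∀ {x y : ℂ} → ℝ.seq (AdjoinI.Carrier.re x) ≡ ℝ.seq (AdjoinI.Carrier.re y) →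
          ℝ.seq (AdjoinI.Carrier.im x) ≡ ℝ.seq (AdjoinI.Carrier.im y) → x ≈ y
seq-≡⇒≈ {x} {y} p q = AdjoinI.mk≈
  (mk≃ (≡.subst (ℝ.seq (AdjoinI.Carrier.re x) ∼_) p (ℝ.cauchy (AdjoinI.Carrier.re x))))
  (mk≃ (≡.subst (ℝ.seq (AdjoinI.Carrier.im x) ∼_) q (ℝ.cauchy (AdjoinI.Carrier.im x))))

fromℚ-+ : ∀ p q → fromℚ (p ℚ.+ q) ≈ fromℚ p + fromℚ q
fromℚ-+ p q = seq-≡⇒≈ ≡.refl ≡.refl

fromℚ-* : ∀ p q → fromℚ (p ℚ.* q) ≈ fromℚ p * fromℚ q
fromℚ-* p q = seq-≡⇒≈
  (≡.cong (λ r _ → r) (≡.sym (≡.trans (≡.cong (λ r → p ℚ.* q ℚ.+ (ℚ.- r)) (ℚ.*-zeroˡ 0ℚ)) (ℚ.+-identityʳ (p ℚ.* q)))))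
  (≡.cong (λ r _ → r) (≡.sym (≡.cong₂ ℚ._+_ (ℚ.*-zeroʳ p) (ℚ.*-zeroˡ q))))

fromℚ-0 : fromℚ 0ℚ ≈ ℂ.0#
fromℚ-0 = seq-≡⇒≈ ≡.refl ≡.refl

fromℚ-1 : fromℚ 1ℚ ≈ ℂ.1#
fromℚ-1 = seq-≡⇒≈ ≡.refl ≡.refl

÷-suc : ∀ z d → z ÷ suc d ≈ z * fromℚ (+ 1 ℚ./ suc d)
÷-suc z d = seq-≡⇒≈ ≡.refl ≡.refl

fromℕ≈fromℚ : ∀ k → fromℕ k ≈ fromℚ (+ k ℚ./ 1)
fromℕ≈fromℚ k = seq-≡⇒≈ ≡.refl ≡.refl

x-y≈x+-y : ∀ x y → x - y ≈ x + - y
x-y≈x+-y x y = seq-≡⇒≈ ≡.refl ≡.refl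

-- The operations of ℂ are inferred from this type in the syntactic form in which they occur in
-- lemma3, so that no element of ℂ is unfolded when Expectation is applied.
ℂ-isCommutativeRing : IsCommutativeRing _≈_ _+_ _*_ -_ ℂ.0# ℂ.1#
ℂ-isCommutativeRing = ℂ.isCommutativeRing

^-arePowers : ∀ w → ArePowers _≈_ _*_ ℂ.1# w (w ^_)
^-arePowers w = record { w^0 = seq-≡⇒≈ ≡.refl ≡.refl ; w^suc = λ k → seq-≡⇒≈ ≡.refl ≡.refl }

Σ[0⋯]≈ : ∀ k g → Σ[0⋯ k ] g ≈ foldr _+_ ℂ.0# (map g (upTo (suc k)))
Σ[0⋯]≈ k g = seq-≡⇒≈ ≡.refl ≡.refl

if-cong : ∀ b {x x′ y y′ : ℂ} → x ≈ x′ → y ≈ y′ → (if b then x else y) ≈ (if b then x′ else y′)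
if-cong true  x≈x′ _    = x≈x′
if-cong false _    y≈y′ = y≈y′

f≈ : ∀ w {n} (l j r : Fin n) → f w (l , j , r) ≈
  (if does (commonSides (l , j , r) ℕ.≟ 1) then (w ^ (toℕ j ∸ toℕ l) + w ^ (toℕ r ∸ toℕ j)) ÷ 2 else ℂ.0#)
f≈ w l j r = if-cong (does (commonSides (l , j , r) ℕ.≟ 1)) (seq-≡⇒≈ ≡.refl ≡.refl) ℂ.refl

𝔼𝒮≈ : ∀ w n → 𝔼 n (𝒮 w) ≈
  foldr _+_ ℂ.0# (map (λ T → foldr _+_ ℂ.0# (map (f w) (triangles T))) (triangulations n)) ÷ length (triangulations n)
𝔼𝒮≈ w n = ℂ.refl

lemma3 : (w : ℂ) (n : ℕ) → 4 ≤ n →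
    𝔼 n (𝒮 w) ≈
    - ((fromℕ (n ∸ 1) * (fromℕ 2 * w ^ (n ∸ 2) + fromℕ 3 * w))
    ÷ (2 ℕ.* (2 ℕ.* n ∸ 5)))
    + ((fromℕ 3 * w) ÷ catalan (n ∸ 2))
    * Σ[0⋯ n ∸ 3 ] (λ j → w ^ j * fromℕ (catalan j) * fromℕ ((2 ℕ.* n ∸ 6 ∸ 2 ℕ.* j) C (n ∸ 3 ∸ j)))
    - (w ÷ (2 ℕ.* catalan (n ∸ 2)))
    * Σ[0⋯ n ∸ 3 ] (λ j → w ^ j * fromℕ (catalan j) * fromℕ ((2 ℕ.* n ∸ 4 ∸ 2 ℕ.* j) C (n ∸ 2 ∸ j)))
lemma3 w n 4≤n = Expectation.expectation ℂ-isCommutativeRing x-y≈x+-y {fromℚ} {fromℕ} {_÷_}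
  fromℚ-+ fromℚ-* fromℚ-0 fromℚ-1 fromℕ≈fromℚ ÷-suc (^-arePowers w) (f≈ w)
  (𝔼 n (𝒮 w)) Σ[0⋯_] n 4≤n Σ[0⋯]≈ (𝔼𝒮≈ w n)
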